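{- Let $n\ge2$, $\alpha,\beta>0$, $a=1/\alpha$, $b=1/\beta$, and let $1\le j_1<\dots<j_r\le n-1$. For $1\le j\le n-1$ let $\alpha_j$ be the event that box $(n-j,j)$ (on the second main diagonal) contains $\alpha$. If $j_k\le j_{k+1}-2$ for all $k=1,\dots,r-1$, then \[\mathbb{P}_{n,\alpha,\beta}(\alpha_{j_1},\dots,\alpha_{j_r})=\prod_{k=1}^{r}\frac{b+j_{r-k+1}-2r+2k-1}{(n+a+b-2r+2k-1)(n+a+b-2r+2k-2)}.\] Otherwise, $\mathbb{P}_{n,\alpha,\beta}(\alpha_{j_1},\dots,\alpha_{j_r})=0$.
   Context: A staircase tableau of size $n$ has boxes $(i,j)$ with $i,j\ge1$ and $i+j\le n+1$, rows numbered from the top and columns from the left. An $\alpha/\beta$-staircase tableau of size $n$ is a filling in which each box is empty or contains $\alpha$ or $\beta$, such that: all boxes in the same column and above an $\alpha$ are empty; all boxes in the same row and to the left of a $\beta$ are empty; every main-diagonal box (with $i+j=n+1$) contains a symbol. $\overline{\mathcal{S}}_n$ is the set of these. The weight is $wt(S)=\alpha^{N_\alpha}\beta^{N_\beta}$ ($N_\alpha,N_\beta$ the numbers of $\alpha$'s, $\beta$'s), and for $\alpha,\beta>0$, $\mathbb{P}_{n,\alpha,\beta}(S)=wt(S)/Z_n(\alpha,\beta)$ with $Z_n(\alpha,\beta)=\sum_{T\in\overline{\mathcal{S}}_n}wt(T)$. The second main diagonal consists of the boxes $(n-j,j)$, $1\le j\le n-1$. $\mathbb{P}_{n,\alpha,\beta}(E_1,\dots,E_r)$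 denotes the probability of the intersection of the events. -}

module Defs where

open import Algebra.Apartness.Bundles using (HeytingCommutativeRing; HeytingField)
import Algebra.Apartness.Properties.HeytingCommutativeRing as HeytingProperties
open import Algebra.Bundles using (CommutativeRing; Semiring)
import Algebra.Definitions.RawSemiring as RawSemiringDefinitions
import Algebra.Properties.Ring as RingProperties
open import Data.Empty using (⊥-elim)
open import Data.Fin.Base using (Fin)
open import Data.Fin.Properties using (all?)
open import Data.List.Base using (List; []; _∷_; cartesianProductWith; filter; foldr; map)
open import Data.List.Membership.Propositional using (_∈_)
open import Data.List.Membership.Propositional.Properties
  using (∈-cartesianProductWith⁺; ∈-filter⁺)
open import Data.List.Relation.Unary.Any using (here; there)
open import Data.Maybe.Base using (Maybe; just; nothing)
open import Data.Maybe.Properties using (≡-dec)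
open import Data.Nat.Base as ℕ using (ℕ; zero; suc; _∸_; z≤n; s≤s)
open import Data.Nat.Properties as ℕ using (_≟_; _≤?_; allUpTo?)
open import Data.Product.Base using (_×_; _,_; proj₁; proj₂)
open import Data.Sum.Base using (_⊎_; inj₁; inj₂)
open import Data.Vec.Base using (Vec; []; _∷_; count; replicate; _∷ʳ_)
open import Level using (Level; 0ℓ; _⊔_) renaming (suc to lsuc)
open import Relation.Binary.Core using (Rel)
open import Relation.Binary.Definitions using (DecidableEquality)
open import Relation.Binary.PropositionalEquality as ≡ using (_≡_; _≢_)
open import Relation.Binary.Structures using (IsStrictPartialOrder)
open import Relation.Nullary.Decidable using (Dec; yes; no; ¬?; _×-dec_; _→-dec_; map′)
open import Relation.Unary using (Pred; Decidable)

------------------------------------------------------------------------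
-- Ordered fields

-- No totality or decidability is assumed of the order, so that the real
-- numbers (classical or constructive) are an instance; "nonzero" is
-- apartness from 0, and apartness means being strictly comparable.
record OrderedField c ℓ₁ ℓ₂ ℓ₃ : Set (lsuc (c ⊔ ℓ₁ ⊔ ℓ₂ ⊔ ℓ₃)) where
  field
    heytingField : HeytingField c ℓ₁ ℓ₂
  open HeytingField heytingField public
  infix 4 _<_
  field
    _<_                  : Rel Carrier ℓ₃
    isStrictPartialOrder : IsStrictPartialOrder _≈_ _<_
    <⇒#                  : ∀ {x y} → x < y → x # y
    #⇒<⊎>                : ∀ {x y} → x # y → x < y ⊎ y < x
    +-monoʳ-<            : ∀ x {y z} → y < z → x + y < x + z
    *-positive           : ∀ {x y} → 0# < x → 0# < y → 0# < x * y

  open IsStrictPartialOrder isStrictPartialOrder public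
    using (<-respʳ-≈; <-respˡ-≈) renaming (trans to <-trans; irrefl to <-irrefl)

  open HeytingCommutativeRing heytingCommutativeRing public using (commutativeRing)
  open CommutativeRing commutativeRing public
    using (ring; semiring; commutativeSemiring)
  open Semiring semiring public using (rawSemiring)

  open RawSemiringDefinitions rawSemiring public
    using (_^_; product) renaming (_×_ to _·_)

  open HeytingProperties heytingCommutativeRing public using (1#0)
  open RingProperties ring using (-1*x≈-x; -‿involutive)

  fromℕ : ℕ → Carrier
  fromℕ n = n · 1#

  >⇒#0 : ∀ {x} → 0# < x → x # 0#
  >⇒#0 0<x = #-sym (<⇒# 0<x)

  infix 8 _⁻¹[_]
  infixl 7 _/_[_]

  _⁻¹[_] : ∀ x → x # 0# → Carrier
  x ⁻¹[ x#0 ] = proj₁ (#⇒invertible x#0)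

  _/_[_] : ∀ x y → y # 0# → Carrier
  x / y [ y#0 ] = x * y ⁻¹[ y#0 ]

  +-positive : ∀ {x y} → 0# < x → 0# < y → 0# < x + y
  +-positive {x} 0<x 0<y =
    <-trans 0<x (<-respˡ-≈ (+-identityʳ x) (+-monoʳ-< x 0<y))

  0<1 : 0# < 1#
  0<1 with #⇒<⊎> 1#0
  ... | inj₂ p = p
  ... | inj₁ p = <-respʳ-≈ (trans (-1*x≈-x (- 1#)) (-‿involutive 1#)) (*-positive 0<-1 0<-1)
    where
    0<-1 : 0# < - 1#
    0<-1 = <-respʳ-≈ (+-identityʳ (- 1#))
             (<-respˡ-≈ (-‿inverseˡ 1#) (+-monoʳ-< (- 1#) p))

  ^-positive : ∀ {x} → 0# < x → ∀ n → 0# < x ^ n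
  ^-positive 0<x zero    = 0<1
  ^-positive 0<x (suc n) = *-positive 0<x (^-positive 0<x n)

  sumOver : ∀ {ℓ} {A : Set ℓ} → List A → (A → Carrier) → Carrier
  sumOver xs f = foldr _+_ 0# (map f xs)

  sumOver-positive : ∀ {ℓ} {A : Set ℓ} (f : A → Carrier) → (∀ x → 0# < f x) →
                     ∀ {x} {xs : List A} → x ∈ xs → 0# < sumOver xs f
  sumOver-positive f pos {xs = y ∷ []}     _         =
    <-respʳ-≈ (sym (+-identityʳ (f y))) (pos y)
  sumOver-positive f pos {xs = y ∷ z ∷ zs} _ =
    +-positive (pos y) (sumOver-positive f pos {xs = z ∷ zs} (here ≡.refl))

------------------------------------------------------------------------
-- Fillings of the staircase

data Symbol : Set where
  `α `β : Symbol

-- An empty box is `nothing`.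
Cell : Set
Cell = Maybe Symbol

_≟ˢ_ : DecidableEquality Symbol
`α ≟ˢ `α = yes ≡.refl
`α ≟ˢ `β = no λ ()
`β ≟ˢ `α = no λ ()
`β ≟ˢ `β = yes ≡.refl

_≟ᶜ_ : DecidableEquality Cell
_≟ᶜ_ = ≡-dec _≟ˢ_

-- The rows from top to bottom, of lengths n, n ∸ 1, …, 1.
infixr 5 _∷_
data Filling : ℕ → Set where
  []  : Filling 0
  _∷_ : ∀ {n} → Vec Cell (suc n) → Filling n → Filling (suc n)

-- Rows and columns are numbered from 1; positions that are not boxes read
-- as empty.
cell : ∀ {m} → Vec Cell m → ℕ → Cell
cell []       _             = nothing
cell (_ ∷ _)  0             = nothing
cell (c ∷ _)  1             = c
cell (_ ∷ cs) (suc (suc j)) = cell cs (suc j)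

entry : ∀ {n} → Filling n → (i j : ℕ) → Cell
entry []      _             _ = nothing
entry (_ ∷ _) 0             _ = nothing
entry (r ∷ _) 1             j = cell r j
entry (_ ∷ S) (suc (suc i)) j = entry S (suc i) j

number : Symbol → ∀ {n} → Filling n → ℕ
number s []      = 0
number s (r ∷ S) = count (_≟ᶜ just s) r ℕ.+ number s S

record IsTableau {n} (S : Filling n) : Set where
  constructor isTableau
  field
    aboveα   : ∀ {i j} → entry S i j ≡ just `α → ∀ {i′} → i′ ℕ.< i → entry S i′ j ≡ nothing
    leftOfβ  : ∀ {i j} → entry S i j ≡ just `β → ∀ {j′} → j′ ℕ.< j → entry S i j′ ≡ nothing
    diagonal : ∀ {i j} → 1 ℕ.≤ i → 1 ℕ.≤ j → i ℕ.+ j ≡ suc n → entry S i j ≢ nothing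

cell-bound : ∀ {m} (r : Vec Cell m) j {s} → cell r j ≡ just s → j ℕ.< suc m
cell-bound (_ ∷ _)  1             _ = s≤s (s≤s z≤n)
cell-bound (_ ∷ cs) (suc (suc j)) e = s≤s (cell-bound cs (suc j) e)

entry-bound : ∀ {n} (S : Filling n) i j {s} → entry S i j ≡ just s →
              i ℕ.< suc n × j ℕ.< suc n
entry-bound (r ∷ _) 1             j e = s≤s (s≤s z≤n) , cell-bound r j e
entry-bound (_ ∷ S) (suc (suc i)) j e with entry-bound S (suc i) j e
... | p , q = s≤s p , ℕ.m<n⇒m<1+n q

isTableau? : ∀ {n} → Decidable (IsTableau {n})
isTableau? {n} S =
  map′ to from
    (       allBoxes? (λ i j → (entry S i j ≟ᶜ just `α) →-dec allUpTo? (λ i′ → entry S i′ j ≟ᶜ nothing) i)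
      ×-dec allBoxes? (λ i j → (entry S i j ≟ᶜ just `β) →-dec allUpTo? (λ j′ → entry S i j′ ≟ᶜ nothing) j)
      ×-dec allBoxes? (λ i j → (1 ≤? i) →-dec (1 ≤? j) →-dec
                               (i ℕ.+ j ≟ suc n) →-dec ¬? (entry S i j ≟ᶜ nothing)))
  where
  AllBoxes : (ℕ → ℕ → Set) → Set
  AllBoxes P = ∀ i j → i ℕ.< suc n → j ℕ.< suc n → P i j

  allBoxes? : ∀ {P} → (∀ i j → Dec (P i j)) → Dec (AllBoxes P)
  allBoxes? P? = map′ (λ f i j u v → f u v) (λ f {i} u {j} v → f i j u v)
                   (allUpTo? (λ i → allUpTo? (P? i) (suc n)) (suc n))

  Bounded : Set
  Bounded =
      AllBoxes (λ i j → entry S i j ≡ just `α → ∀ {i′} → i′ ℕ.< i → entry S i′ j ≡ nothing)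
    × AllBoxes (λ i j → entry S i j ≡ just `β → ∀ {j′} → j′ ℕ.< j → entry S i j′ ≡ nothing)
    × AllBoxes (λ i j → 1 ℕ.≤ i → 1 ℕ.≤ j → i ℕ.+ j ≡ suc n → entry S i j ≢ nothing)

  diagonal-bound : ∀ {i j} → 1 ℕ.≤ i → 1 ℕ.≤ j → i ℕ.+ j ≡ suc n → i ℕ.< suc n × j ℕ.< suc n
  diagonal-bound {i} {j} u v e =
      ≡.subst (i ℕ.<_) e (ℕ.m<m+n i v)
    , ≡.subst (j ℕ.<_) e (ℕ.m<n+m j u)

  to : Bounded → IsTableau S
  to (p , q , d) = isTableau
    (λ {i} {j} e → p i j (proj₁ (entry-bound S i j e)) (proj₂ (entry-bound S i j e)) e)
    (λ {i} {j} e → q i j (proj₁ (entry-bound S i j e)) (proj₂ (entry-bound S i j e)) e)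
    (λ {i} {j} u v e → d i j (proj₁ (diagonal-bound u v e)) (proj₂ (diagonal-bound u v e)) u v e)

  from : IsTableau S → Bounded
  from (isTableau p q d) = (λ _ _ _ _ → p) , (λ _ _ _ _ → q) , (λ _ _ _ _ → d)

cells : List Cell
cells = nothing ∷ just `α ∷ just `β ∷ []

rows : ∀ m → List (Vec Cell m)
rows zero    = [] ∷ []
rows (suc m) = cartesianProductWith _∷_ cells (rows m)

fillings : ∀ n → List (Filling n)
fillings zero    = [] ∷ []
fillings (suc n) = cartesianProductWith _∷_ (rows (suc n)) (fillings n)

tableaux : ∀ n → List (Filling n)
tableaux n = filter isTableau? (fillings n)

∈-cells : ∀ c → c ∈ cells
∈-cells nothing   = here ≡.refl
∈-cells (just `α) = there (here ≡.refl)
∈-cells (just `β) = there (there (here ≡.refl))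

∈-rows : ∀ {m} (r : Vec Cell m) → r ∈ rows m
∈-rows []       = here ≡.refl
∈-rows (c ∷ cs) = ∈-cartesianProductWith⁺ _∷_ (∈-cells c) (∈-rows cs)

∈-fillings : ∀ {n} (S : Filling n) → S ∈ fillings n
∈-fillings []      = here ≡.refl
∈-fillings (r ∷ S) = ∈-cartesianProductWith⁺ _∷_ (∈-rows r) (∈-fillings S)

∈-tableaux : ∀ {n} {S : Filling n} → IsTableau S → S ∈ tableaux n
∈-tableaux {S = S} = ∈-filter⁺ isTableau? (∈-fillings S)

-- A member of `tableaux n`, used only to see that the partition function is
-- positive.
αDiagonal : ∀ n → Filling n
αDiagonal zero    = []
αDiagonal (suc n) = (replicate n nothing ∷ʳ just `α) ∷ αDiagonal n

αDiagonal-isTableau : ∀ n → IsTableau (αDiagonal n)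
αDiagonal-isTableau n = isTableau above left on
  where
  row : ∀ m j {s} → cell (replicate m nothing ∷ʳ just `α) j ≡ just s → j ≡ suc m × s ≡ `α
  row zero    1             ≡.refl = ≡.refl , ≡.refl
  row (suc m) (suc (suc j)) e with row m (suc j) e
  ... | p , q = ≡.cong suc p , q

  row-last : ∀ m → cell (replicate m nothing ∷ʳ just `α) (suc m) ≡ just `α
  row-last zero    = ≡.refl
  row-last (suc m) = row-last m

  only : ∀ n i j {s} → entry (αDiagonal n) i j ≡ just s → i ℕ.+ j ≡ suc n × s ≡ `α
  only (suc n) 1             j e with row n j e
  ... | p , q = ≡.cong suc p , q
  only (suc n) (suc (suc i)) j e with only n (suc i) j e
  ... | p , q = ≡.cong suc p , q

  filled : ∀ n i j → 1 ℕ.≤ i → 1 ℕ.≤ j → i ℕ.+ j ≡ suc n → entry (αDiagonal n) i j ≡ just `α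
  filled zero    (suc i)       (suc j) _ _ e rewrite ℕ.+-suc i j with () ← e
  filled (suc n) 1             j       _ _ ≡.refl = row-last n
  filled (suc n) (suc (suc i)) j       _ v e =
    filled n (suc i) j (s≤s z≤n) v (≡.cong ℕ.pred e)

  above : ∀ {i j} → entry (αDiagonal n) i j ≡ just `α →
          ∀ {i′} → i′ ℕ.< i → entry (αDiagonal n) i′ j ≡ nothing
  above {i} {j} e {i′} i′<i with entry (αDiagonal n) i′ j in e′
  ... | nothing = ≡.refl
  ... | just s  = ⊥-elim (ℕ.<⇒≢ i′<i (ℕ.+-cancelʳ-≡ j i′ i
                    (≡.trans (proj₁ (only n i′ j e′)) (≡.sym (proj₁ (only n i j e))))))

  left : ∀ {i j} → entry (αDiagonal n) i j ≡ just `β →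
         ∀ {j′} → j′ ℕ.< j → entry (αDiagonal n) i j′ ≡ nothing
  left {i} {j} e with () ← proj₂ (only n i j e)

  on : ∀ {i j} → 1 ℕ.≤ i → 1 ℕ.≤ j → i ℕ.+ j ≡ suc n → entry (αDiagonal n) i j ≢ nothing
  on {i} {j} u v e e′ with () ← ≡.trans (≡.sym (filled n i j u v e)) e′

------------------------------------------------------------------------
-- Events

record Event (n : ℕ) : Set₁ where
  field
    Occurs  : Pred (Filling n) 0ℓ
    occurs? : Decidable Occurs

⋂ : ∀ {n r} → (Fin r → Event n) → Event n
⋂ E = record
  { Occurs  = λ S → ∀ k → Event.Occurs (E k) S
  ; occurs? = λ S → all? (λ k → Event.occurs? (E k) S)
  }

αOnSecondDiagonal : ∀ n → ℕ → Event n
αOnSecondDiagonal n j = record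
  { Occurs  = λ S → entry S (n ∸ j) j ≡ just `α
  ; occurs? = λ S → entry S (n ∸ j) j ≟ᶜ just `α
  }

------------------------------------------------------------------------
-- The probability measure

module StaircaseProbability {c ℓ₁ ℓ₂ ℓ₃} (F : OrderedField c ℓ₁ ℓ₂ ℓ₃) where
  open OrderedField F

  wt : (α β : Carrier) → ∀ {n} → Filling n → Carrier
  wt α β S = α ^ number `α S * β ^ number `β S

  Z : ℕ → (α β : Carrier) → Carrier
  Z n α β = sumOver (tableaux n) (wt α β)

  module _ (n : ℕ) {α β : Carrier} (α>0 : 0# < α) (β>0 : 0# < β) where

    Z-positive : 0# < Z n α β
    Z-positive = sumOver-positive (wt α β)
      (λ S → *-positive (^-positive α>0 (number `α S)) (^-positive β>0 (number `β S)))
      (∈-tableaux (αDiagonal-isTableau n))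

    ℙ₁ : Filling n → Carrier
    ℙ₁ S = wt α β S / Z n α β [ >⇒#0 Z-positive ]

    ℙ : ∀ {r} → (Fin r → Event n) → Carrier
    ℙ E = sumOver (filter (Event.occurs? (⋂ E)) (tableaux n)) ℙ₁

{-# OPTIONS --safe #-}

-- Add the rows one at a time, from the bottom to the top, and record the
-- generating function G(y) of the weights in which y marks the columns that
-- contain no α. An unconstrained row replaces G(y) by (α + β y) G(y + α). An α
-- in box (n − j, j) forces α and β in the diagonal boxes to its right and
-- below it; treating its row and the row below it as one step replaces G(y) by
--   αβ ((α + β y) G(y + α) − β y G(y)).
-- Put L_k(y) = ∏_{i<k} (α + β y + i αβ). The first step sends
-- L_k to L_{k+1}, the second sends L_k to (αβ)² (b + k) L_k. Hence every joint
-- probability is a product of constants times L_{n−2r}(1) / L_n(1).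
module Submission where

open import Defs
import Algebra.Properties.Group as GroupProperties
import Algebra.Properties.Monoid.Mult as MonoidMult
import Algebra.Properties.Ring as RingProperties
import Algebra.Properties.Semiring.Exp as SemiringExp
import Algebra.Solver.Ring.NaturalCoefficients.Default as RingSolver
open import Algebra.Bundles using (CommutativeRing)
open import Data.Bool.Base using (Bool; true; false; not; _∧_; T; if_then_else_)
open import Data.Bool.Properties using (T-∧; T?; ∧-zeroʳ; ∧-identityʳ; ∧-idem; ∧-assoc)
open import Data.Empty using (⊥-elim)
open import Data.Fin.Base as Fin using (Fin; zero; suc; toℕ; opposite; fromℕ<; inject₁)
open import Data.Fin.Properties
  using (toℕ-inject₁; toℕ-fromℕ; toℕ-fromℕ<; toℕ<n; opposite-prop)
open import Data.Fin.Relation.Unary.Top using (view; ‵fromℕ; ‵inject₁)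
open import Data.List.Base as List using (List; []; _∷_; cartesianProductWith; filter)
open import Data.List.Properties using (filter-none)
import Data.List.Relation.Unary.All as All
open import Data.List.Relation.Unary.All.Properties using (all-filter)
open import Data.Maybe.Base using (just; nothing)
open import Data.Nat.Base as ℕ using (ℕ; zero; suc; _≤_; _∸_; z≤n; s≤s)
import Data.Nat.Properties as ℕ
open import Data.Nat.Solver using (module +-*-Solver)
open import Data.Product.Base using (Σ; _×_; _,_; proj₁; proj₂)
open import Data.Sum.Base using (inj₁; inj₂)
open import Data.Unit.Base using (tt)
open import Data.Vec.Base using (Vec; []; _∷_; count; _∷ʳ_)
open import Function.Base using (_∘_)
open import Function.Bundles using (_⇔_; mk⇔; Equivalence)
import Relation.Binary.Reasoning.Setoid as SetoidReasoning
open import Relation.Binary.PropositionalEquality as ≡ using (_≡_; _≢_)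
open import Relation.Nullary.Decidable using (does; does-⇔; yes; no; _×-dec_)
open import Relation.Nullary.Negation using (¬_; contradiction)
open import Relation.Unary using (Pred; Decidable)

open Equivalence using (to; from)

-- Validity of a filling, row by row

-- One variable y suffices because a new row sees the rows below only through the set of columns
-- free of α, and its summed weight depends only on the size of that set. An α beside the diagonal
-- breaks this symmetry: it asks for one particular column, the newest one, to be free, and G(y)
-- does not record that. Hence its row is taken together with the row below. There the diagonal box
-- cannot be α, since it has a symbol above it; it is β, and this β empties the rest of its row, so
-- the lower row is determined. In the upper row the diagonal box cannot be β, so it is α. Deleting
-- that box leaves an ordinary row over the old columns whose own diagonal box is α: all rows, minus
-- those ending in β. The latter are otherwise empty, which is the origin of the term - βy G(y). On
-- L_k the two terms combine through α + βy + kαβ - βy = αβ(b + k). A gap of at least 2 between the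
-- columns makes the pairs of rows disjoint.

cell-zero : ∀ {m} (r : Vec Cell m) → cell r 0 ≡ nothing
cell-zero []      = ≡.refl
cell-zero (_ ∷ _) = ≡.refl

entry-zero : ∀ {n} (S : Filling n) {j} → entry S 0 j ≡ nothing
entry-zero []      = ≡.refl
entry-zero (_ ∷ _) = ≡.refl

isα : Cell → Bool
isα c = does (c ≟ᶜ just `α)

withoutβ : ∀ {m} → Vec Cell m → Bool
withoutβ []              = true
withoutβ (just `β ∷ _)   = false
withoutβ (nothing ∷ cs)  = withoutβ cs
withoutβ (just `α ∷ cs)  = withoutβ cs

-- The vector tells for each column below whether it is free of α's; the
-- last box of the row is on the diagonal and starts a column of its own.
fits : ∀ {m} → Vec Bool m → Vec Cell (suc m) → Bool
fits []       (nothing ∷ []) = false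
fits []       (just _ ∷ [])  = true
fits (b ∷ bs) (nothing ∷ cs) = fits bs cs
fits (b ∷ bs) (just _ ∷ cs)  = b ∧ (withoutβ cs ∧ fits bs cs)

placeRow : ∀ {m} → Vec Bool m → Vec Cell (suc m) → Vec Bool (suc m)
placeRow []       (c ∷ [])  = not (isα c) ∷ []
placeRow (b ∷ bs) (c ∷ cs)  = (b ∧ not (isα c)) ∷ placeRow bs cs

free : ∀ {n} → Filling n → Vec Bool n
free []      = []
free (r ∷ S) = placeRow (free S) r

valid : ∀ {n} → Filling n → Bool
valid []      = true
valid (r ∷ S) = fits (free S) r ∧ valid S

-- The default `true` beyond the vector is needed for the diagonal box of the next row, whose column
-- has nothing below it.
freeAt : ∀ {m} → Vec Bool m → ℕ → Bool
freeAt []       _             = true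
freeAt (_ ∷ _)  0             = true
freeAt (b ∷ _)  1             = b
freeAt (_ ∷ bs) (suc (suc j)) = freeAt bs (suc j)

freeAt-placeRow : ∀ {m} (v : Vec Bool m) r j →
                  freeAt (placeRow v r) j ≡ freeAt v j ∧ not (isα (cell r j))
freeAt-placeRow []       (c ∷ [])        0             = ≡.refl
freeAt-placeRow []       (c ∷ [])        1             = ≡.refl
freeAt-placeRow []       (c ∷ [])        (suc (suc j)) = ≡.refl
freeAt-placeRow (b ∷ bs) (c ∷ cs)        0             = ≡.refl
freeAt-placeRow (b ∷ bs) (c ∷ cs)        1             = ≡.refl
freeAt-placeRow (b ∷ [])      (c ∷ cs) (suc (suc j)) = freeAt-placeRow [] cs (suc j)
freeAt-placeRow (b ∷ b′ ∷ bs) (c ∷ cs) (suc (suc j)) = freeAt-placeRow (b′ ∷ bs) cs (suc j)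

T-not-isα : ∀ c → T (not (isα c)) ⇔ (c ≢ just `α)
T-not-isα nothing   = mk⇔ (λ _ ()) (λ _ → tt)
T-not-isα (just `α) = mk⇔ (λ ()) (λ ne → ne ≡.refl)
T-not-isα (just `β) = mk⇔ (λ _ ()) (λ _ → tt)

T-freeAt : ∀ {n} (S : Filling n) j → T (freeAt (free S) j) ⇔ (∀ i → entry S i j ≢ just `α)
T-freeAt []      j = mk⇔ (λ _ _ ()) (λ _ → tt)
T-freeAt (r ∷ S) j rewrite freeAt-placeRow (free S) r j = mk⇔ ⇒ ⇐
  where
  ⇒ : T (freeAt (free S) j ∧ not (isα (cell r j))) → ∀ i → entry (r ∷ S) i j ≢ just `α
  ⇒ t 0             ()
  ⇒ t 1             = to (T-not-isα (cell r j)) (proj₂ (to T-∧ t))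
  ⇒ t (suc (suc i)) = to (T-freeAt S j) (proj₁ (to T-∧ t)) (suc i)

  ⇐ : (∀ i → entry (r ∷ S) i j ≢ just `α) → T (freeAt (free S) j ∧ not (isα (cell r j)))
  ⇐ h = from T-∧ (from (T-freeAt S j) (λ { zero e → contradiction (≡.trans (≡.sym e) (entry-zero S)) λ () ; (suc i) → h (suc (suc i)) })
                 , from (T-not-isα (cell r j)) (h 1))

T-withoutβ : ∀ {m} (cs : Vec Cell m) → T (withoutβ cs) ⇔ (∀ j → cell cs j ≢ just `β)
T-withoutβ []       = mk⇔ (λ _ _ ()) (λ _ → tt)
T-withoutβ (c ∷ cs) = mk⇔ (⇒ c) (⇐ c)
  where
  ⇒ : ∀ c → T (withoutβ (c ∷ cs)) → ∀ j → cell (c ∷ cs) j ≢ just `β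
  ⇒ _         t 0             ()
  ⇒ nothing   t 1             ()
  ⇒ (just `α) t 1             ()
  ⇒ nothing   t (suc (suc j)) = to (T-withoutβ cs) t (suc j)
  ⇒ (just `α) t (suc (suc j)) = to (T-withoutβ cs) t (suc j)

  tail : ∀ c → (∀ j → cell (c ∷ cs) j ≢ just `β) → ∀ j → cell cs j ≢ just `β
  tail c h zero    e with () ← ≡.trans (≡.sym e) (cell-zero cs)
  tail c h (suc j) = h (suc (suc j))

  ⇐ : ∀ c → (∀ j → cell (c ∷ cs) j ≢ just `β) → T (withoutβ (c ∷ cs))
  ⇐ nothing   h = from (T-withoutβ cs) (tail nothing h)
  ⇐ (just `α) h = from (T-withoutβ cs) (tail (just `α) h)
  ⇐ (just `β) h = h 1 ≡.refl

-- The tableau conditions as they concern a new top row. `onFree` is the condition on α's, read from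
-- the upper box instead of from the α.
record Fits {m} (v : Vec Bool m) (r : Vec Cell (suc m)) : Set where
  field
    onFree  : ∀ {j s} → cell r j ≡ just s → T (freeAt v j)
    leftOfβ : ∀ {j} → cell r j ≡ just `β → ∀ {j′} → j′ ℕ.< j → cell r j′ ≡ nothing
    last    : cell r (suc m) ≢ nothing

open Fits

-- `fits` scans from the left, so the condition on β is turned around: a symbol tolerates no β to
-- its right.
T-fits : ∀ {m} (v : Vec Bool m) r → T (fits v r) ⇔ Fits v r
T-fits [] (nothing ∷ []) = mk⇔ (λ ()) (λ f → last f ≡.refl)
T-fits [] (just s ∷ [])  = mk⇔ (λ _ → record { onFree = λ _ → tt ; leftOfβ = left ; last = λ () }) (λ _ → tt)
  where
  left : ∀ {j} → cell (just s ∷ []) j ≡ just `β → ∀ {j′} → j′ ℕ.< j → cell (just s ∷ []) j′ ≡ nothing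
  left {0}           e ()
  left {1}           e {zero}  _ = ≡.refl
  left {1}           e {suc _} (s≤s ())
  left {suc (suc j)} ()
T-fits (b ∷ bs) (c ∷ cs) = mk⇔ (⇒ c) (⇐ c)
  where
  ⇒ : ∀ c → T (fits (b ∷ bs) (c ∷ cs)) → Fits (b ∷ bs) (c ∷ cs)
  ⇒ nothing t = record { onFree = λ {j} → on {j} ; leftOfβ = left ; last = last f }
    where
    f = to (T-fits bs cs) t
    on : ∀ {j s} → cell (nothing ∷ cs) j ≡ just s → T (freeAt (b ∷ bs) j)
    on {suc (suc j)} = onFree f
    left : ∀ {j} → cell (nothing ∷ cs) j ≡ just `β → ∀ {j′} → j′ ℕ.< j → cell (nothing ∷ cs) j′ ≡ nothing
    left {suc (suc j)} e {0}            _       = ≡.refl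
    left {suc (suc j)} e {1}            _       = ≡.refl
    left {suc (suc j)} e {suc (suc j′)} (s≤s l) = leftOfβ f e l
  ⇒ (just s) t = record { onFree = λ {j} → on {j} ; leftOfβ = left ; last = last f }
    where
    bt = to T-∧ t
    tt′ = to T-∧ (proj₂ bt)
    f = to (T-fits bs cs) (proj₂ tt′)
    on : ∀ {j s′} → cell (just s ∷ cs) j ≡ just s′ → T (freeAt (b ∷ bs) j)
    on {0}           _ = tt
    on {1}           _ = proj₁ bt
    on {suc (suc j)} e = onFree f e
    left : ∀ {j} → cell (just s ∷ cs) j ≡ just `β → ∀ {j′} → j′ ℕ.< j → cell (just s ∷ cs) j′ ≡ nothing
    left {1}           e {0}            _            = ≡.refl
    left {1}           e {suc j′}       (s≤s ())
    left {suc (suc j)} e = ⊥-elim (to (T-withoutβ cs) (proj₁ tt′) (suc j) e)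

  tail : ∀ {c} → Fits (b ∷ bs) (c ∷ cs) → Fits bs cs
  tail {c} f = record { onFree = λ {j} → on {j} ; leftOfβ = left ; last = last f }
    where
    on : ∀ {j s} → cell cs j ≡ just s → T (freeAt bs j)
    on {zero}  e with () ← ≡.trans (≡.sym e) (cell-zero cs)
    on {suc j} e = onFree f {suc (suc j)} e
    left : ∀ {j} → cell cs j ≡ just `β → ∀ {j′} → j′ ℕ.< j → cell cs j′ ≡ nothing
    left {j}     e {zero}   _ = cell-zero cs
    left {suc j} e {suc j′} l = leftOfβ f {suc (suc j)} e {suc (suc j′)} (s≤s l)

  ⇐ : ∀ c → Fits (b ∷ bs) (c ∷ cs) → T (fits (b ∷ bs) (c ∷ cs))
  ⇐ nothing  f = from (T-fits bs cs) (tail f)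
  ⇐ (just s) f = from T-∧ (onFree f {1} ≡.refl , from T-∧
    (from (T-withoutβ cs) noβ , from (T-fits bs cs) (tail f)))
    where
    noβ : ∀ j → cell cs j ≢ just `β
    noβ zero    e with () ← ≡.trans (≡.sym e) (cell-zero cs)
    noβ (suc j) e with () ← leftOfβ f {suc (suc j)} e {1} (s≤s (s≤s z≤n))

-- Without its top row a staircase is a smaller staircase with the same column numbers and row
-- numbers lowered by one, so each condition splits into a part for the top row and a part for the
-- rest.
T-valid : ∀ {n} (S : Filling n) → T (valid S) ⇔ IsTableau S
T-valid [] = mk⇔ (λ _ → isTableau (λ ()) (λ ()) λ { {zero} () ; {suc i} _ (s≤s _) e → contradiction (ℕ.suc-injective e) (ℕ.m+1+n≢0 i) }) (λ _ → tt)
T-valid {suc n} (r ∷ S) = mk⇔ ⇒ ⇐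
  where
  ⇒ : T (valid (r ∷ S)) → IsTableau (r ∷ S)
  ⇒ t = isTableau above (λ {i} → left {i}) on
    where
    parts = to (T-∧ {fits (free S) r}) t
    f = to (T-fits (free S) r) (proj₁ parts)
    module S = IsTableau (to (T-valid S) (proj₂ parts))
    cleared : ∀ {i j} → entry S (suc i) j ≡ just `α → cell r j ≡ nothing
    cleared {i} {j} e with cell r j in e′
    ... | nothing = ≡.refl
    ... | just _  = contradiction e (to (T-freeAt S j) (onFree f e′) (suc i))
    above : ∀ {i j} → entry (r ∷ S) i j ≡ just `α → ∀ {i′} → i′ ℕ.< i → entry (r ∷ S) i′ j ≡ nothing
    above {1}           e {0}            _       = ≡.refl
    above {1}           e {suc _}        (s≤s ())
    above {suc (suc i)} e {0}            _       = ≡.refl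
    above {suc (suc i)} e {1}            _       = cleared e
    above {suc (suc i)} e {suc (suc i′)} (s≤s l) = S.aboveα e l
    left : ∀ {i j} → entry (r ∷ S) i j ≡ just `β → ∀ {j′} → j′ ℕ.< j → entry (r ∷ S) i j′ ≡ nothing
    left {1}           e l = leftOfβ f e l
    left {suc (suc i)} e l = S.leftOfβ e l
    on : ∀ {i j} → 1 ≤ i → 1 ≤ j → i ℕ.+ j ≡ suc (suc n) → entry (r ∷ S) i j ≢ nothing
    on {1}           _ _ ≡.refl = last f
    on {suc (suc i)} _ v e      = S.diagonal (s≤s z≤n) v (ℕ.suc-injective e)

  ⇐ : IsTableau (r ∷ S) → T (valid (r ∷ S))
  ⇐ t = from T-∧ (from (T-fits (free S) r) f , from (T-valid S) (isTableau above left on))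
    where
    module t = IsTableau t
    f : Fits (free S) r
    f = record
      { onFree = λ {j} e → from (T-freeAt S j) λ
          { zero    e′ → contradiction (≡.trans (≡.sym e′) (entry-zero S)) λ ()
          ; (suc i) e′ → contradiction (≡.trans (≡.sym e) (t.aboveα {suc (suc i)} e′ {1} (s≤s (s≤s z≤n)))) λ () }
      ; leftOfβ = t.leftOfβ {1}
      ; last = t.diagonal {1} (s≤s z≤n) (s≤s z≤n) ≡.refl }
    above : ∀ {i j} → entry S i j ≡ just `α → ∀ {i′} → i′ ℕ.< i → entry S i′ j ≡ nothing
    above {suc i} e {zero}   _ = entry-zero S
    above {suc i} e {suc i′} l = t.aboveα {suc (suc i)} e {suc (suc i′)} (s≤s l)
    left : ∀ {i j} → entry S i j ≡ just `β → ∀ {j′} → j′ ℕ.< j → entry S i j′ ≡ nothing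
    left {zero}  _ _ = entry-zero S
    left {suc i} e = t.leftOfβ {suc (suc i)} e
    on : ∀ {i j} → 1 ≤ i → 1 ≤ j → i ℕ.+ j ≡ suc n → entry S i j ≢ nothing
    on {suc i} _ v e = t.diagonal {suc (suc i)} (s≤s z≤n) v (≡.cong suc e)

-- Trades the bounded search that defines `tableaux` for a recursion on rows, along which sums can
-- be split.
does-isTableau? : ∀ {n} (S : Filling n) → does (isTableau? S) ≡ valid S
does-isTableau? S = does-⇔ (mk⇔ (from (T-valid S)) (to (T-valid S))) (isTableau? S) (T? (valid S))

-- The events on the second main diagonal

Allα : ∀ {n r} → (Fin r → ℕ) → Event n
Allα {n} j = ⋂ (λ k → αOnSecondDiagonal n (j k))

allα : ∀ {n r} → (Fin r → ℕ) → Filling n → Bool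
allα j S = does (Event.occurs? (Allα j) S)

-- A new top row raises the size and all row numbers together, so the second diagonal keeps its box
-- in column `j`. The bound on `j` makes n - j positive, so that the box lies below the new row.
entry-∷ : ∀ {n} r (S : Filling n) {j} → j ℕ.< n →
          entry (r ∷ S) (suc n ∸ j) j ≡ entry S (n ∸ j) j
entry-∷ {n} r S {j} j<n rewrite ℕ.+-∸-assoc 1 (ℕ.<⇒≤ j<n) with n ∸ j | ℕ.m<n⇒0<n∸m j<n
... | suc _ | _ = ≡.refl

allα-∷ : ∀ {n r} (j : Fin r → ℕ) row (S : Filling n) → (∀ k → j k ℕ.< n) →
         allα j (row ∷ S) ≡ allα j S
allα-∷ {n} j row S j<n = does-⇔
  (mk⇔ (λ h k → ≡.trans (≡.sym (entry-∷ row S (j<n k))) (h k))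
       (λ h k → ≡.trans (entry-∷ row S (j<n k)) (h k)))
  (Event.occurs? (Allα j) (row ∷ S)) (Event.occurs? (Allα j) S)

-- In size n + 2 the second diagonal meets column n + 1 in the top row, while its columns below n
-- are met under both new rows. The row `row₁` is therefore not constrained by the event itself.
allα-last : ∀ {n r} (j : Fin (suc r) → ℕ) row₂ row₁ (S : Filling n) →
            j (Fin.fromℕ r) ≡ suc n → (∀ k → j (inject₁ k) ℕ.< n) →
            allα j (row₂ ∷ row₁ ∷ S) ≡ isα (cell row₂ (suc n)) ∧ allα (j ∘ inject₁) S
allα-last {n} {r} j row₂ row₁ S eq j<n = does-⇔ (mk⇔ ⇒ ⇐)
  (Event.occurs? (Allα j) (row₂ ∷ row₁ ∷ S))
  ((cell row₂ (suc n) ≟ᶜ just `α) ×-dec Event.occurs? (Allα (j ∘ inject₁)) S)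
  where
  top : entry (row₂ ∷ row₁ ∷ S) (suc (suc n) ∸ j (Fin.fromℕ r)) (j (Fin.fromℕ r)) ≡ cell row₂ (suc n)
  top rewrite eq | ℕ.m+n∸n≡m 1 n = ≡.refl

  rest : ∀ k → entry (row₂ ∷ row₁ ∷ S) (suc (suc n) ∸ j (inject₁ k)) (j (inject₁ k)) ≡
               entry S (n ∸ j (inject₁ k)) (j (inject₁ k))
  rest k = ≡.trans (entry-∷ row₂ (row₁ ∷ S) (ℕ.m<n⇒m<1+n (j<n k))) (entry-∷ row₁ S (j<n k))

  ⇒ : Event.Occurs (Allα j) (row₂ ∷ row₁ ∷ S) →
      cell row₂ (suc n) ≡ just `α × Event.Occurs (Allα (j ∘ inject₁)) S
  ⇒ h = ≡.trans (≡.sym top) (h (Fin.fromℕ r)) , λ k → ≡.trans (≡.sym (rest k)) (h (inject₁ k))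

  ⇐ : cell row₂ (suc n) ≡ just `α × Event.Occurs (Allα (j ∘ inject₁)) S →
      Event.Occurs (Allα j) (row₂ ∷ row₁ ∷ S)
  ⇐ (h , hs) k with view k
  ... | ‵fromℕ    = ≡.trans top h
  ... | ‵inject₁ k = ≡.trans (rest k) (hs k)

-- Ranges over all pairs, not only neighbours, so that it restricts to initial segments and compares
-- every column directly with the last one.
Gapped : ∀ {r} → (Fin r → ℕ) → Set
Gapped j = ∀ {k l} → k Fin.< l → j k ℕ.+ 2 ≤ j l

Gapped-init : ∀ {r} {j : Fin (suc r) → ℕ} → Gapped j → Gapped (j ∘ inject₁)
Gapped-init gap {k} {l} k<l = gap (≡.subst₂ ℕ._<_ (≡.sym (toℕ-inject₁ k)) (≡.sym (toℕ-inject₁ l)) k<l)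

inject₁<fromℕ : ∀ {r} (k : Fin r) → inject₁ k Fin.< Fin.fromℕ r
inject₁<fromℕ {r} k rewrite toℕ-inject₁ k | toℕ-fromℕ r = toℕ<n k

-- Each earlier α uses up two columns. This bound keeps the natural-number subtractions in `factor`
-- and in the exponents from being truncated.
Gapped-lower : ∀ {r} (j : Fin r → ℕ) → (∀ k → 1 ≤ j k) → Gapped j → ∀ k → suc (toℕ k ℕ.* 2) ≤ j k
Gapped-lower {suc r} j 1≤j gap k with view k
... | ‵inject₁ k rewrite toℕ-inject₁ k = Gapped-lower (j ∘ inject₁) (1≤j ∘ inject₁) (Gapped-init gap) k
Gapped-lower {suc zero}    j 1≤j gap .(Fin.fromℕ 0)       | ‵fromℕ = 1≤j zero
Gapped-lower {suc (suc r)} j 1≤j gap .(Fin.fromℕ (suc r)) | ‵fromℕ = begin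
  suc (suc (toℕ (Fin.fromℕ r)) ℕ.* 2)         ≡⟨ ≡.cong suc (ℕ.+-comm 2 _) ⟩
  suc (toℕ (Fin.fromℕ r) ℕ.* 2) ℕ.+ 2         ≤⟨ ℕ.+-monoˡ-≤ 2 (Gapped-lower (j ∘ inject₁) (1≤j ∘ inject₁) (Gapped-init gap) (Fin.fromℕ r)) ⟩
  j (inject₁ (Fin.fromℕ r)) ℕ.+ 2              ≤⟨ gap (inject₁<fromℕ (Fin.fromℕ r)) ⟩
  j (Fin.fromℕ (suc r))                        ∎
  where open ℕ.≤-Reasoning

Gapped-room : ∀ {n r} (j : Fin r → ℕ) → (∀ k → 1 ≤ j k) → Gapped j → (∀ k → j k ℕ.< n) → r ℕ.* 2 ≤ n
Gapped-room {r = zero}      j 1≤j gap j<n = z≤n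
Gapped-room {n} {r = suc r} j 1≤j gap j<n = ≡.subst (λ x → suc (suc (x ℕ.* 2)) ≤ n) (toℕ-fromℕ r)
  (ℕ.≤-trans (s≤s (Gapped-lower j 1≤j gap (Fin.fromℕ r))) (j<n (Fin.fromℕ r)))

separated⇒Gapped : ∀ {r} {j : Fin r → ℕ} → (∀ k l → k Fin.< l → j k ℕ.< j l) →
                   (∀ k l → toℕ l ≡ suc (toℕ k) → j k ℕ.+ 2 ≤ j l) → Gapped j
separated⇒Gapped {r} {j} mono sep {k} {l} k<l with ℕ.m≤n⇒m<n∨m≡n k<l
... | inj₂ eq  = sep k l (≡.sym eq)
... | inj₁ k+<l = ℕ.≤-trans (sep k k⁺ k⁺≡) (ℕ.<⇒≤ (mono k⁺ l (≡.subst (ℕ._< toℕ l) (≡.sym k⁺≡) k+<l)))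
  where
  k⁺  = fromℕ< (ℕ.≤-trans k+<l (ℕ.<⇒≤ (toℕ<n l)))
  k⁺≡ : toℕ k⁺ ≡ suc (toℕ k)
  k⁺≡ = toℕ-fromℕ< _

-- The diagonal box (n - j, j + 1) lies to the right of one of the two boxes and below the other. It
-- is not empty; a β in it clears the first, an α clears the second.
no-adjacent-α : ∀ {n} {S : Filling n} → IsTableau S → ∀ {j} → j ℕ.< n →
                entry S (n ∸ j) j ≡ just `α → entry S (n ∸ suc j) (suc j) ≢ just `α
no-adjacent-α {n} {S} t {j} j<n e e′ with entry S (n ∸ j) (suc j) in d
... | nothing = IsTableau.diagonal t {n ∸ j} {suc j} (ℕ.m<n⇒0<n∸m j<n) (s≤s z≤n)
                  (≡.trans (ℕ.+-suc (n ∸ j) j) (≡.cong suc (ℕ.m∸n+n≡m (ℕ.<⇒≤ j<n)))) d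
... | just `α with () ← ≡.trans (≡.sym e′) (IsTableau.aboveα t d (ℕ.∸-monoʳ-< ℕ.≤-refl j<n))
... | just `β with () ← ≡.trans (≡.sym e) (IsTableau.leftOfβ t d ℕ.≤-refl)

allα⇒separated : ∀ {n r} {S : Filling n} (j : Fin r → ℕ) → (∀ k → j k ℕ.< n) →
                 (∀ k l → k Fin.< l → j k ℕ.< j l) → IsTableau S → Event.Occurs (Allα j) S →
                 ∀ k l → toℕ l ≡ suc (toℕ k) → j k ℕ.+ 2 ≤ j l
allα⇒separated {n} {S = S} j j<n mono t occ k l l≡ with ℕ.m≤n⇒m<n∨m≡n (mono k l (ℕ.≤-reflexive (≡.sym l≡)))
... | inj₁ lt = ≡.subst (_≤ j l) (ℕ.+-comm 2 (j k)) lt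
... | inj₂ eq = contradiction (≡.subst (λ x → entry S (n ∸ x) x ≡ just `α) (≡.sym eq) (occ l))
                  (no-adjacent-α t (j<n k) (occ k))

-- Generating functions

module Weights {c ℓ₁ ℓ₂ ℓ₃} (F : OrderedField c ℓ₁ ℓ₂ ℓ₃) where
  open OrderedField F hiding (zero)
  open CommutativeRing commutativeRing using (+-monoid; +-group)
  open GroupProperties +-group using () renaming (∙-cancelʳ to +-cancelʳ)
  open RingSolver commutativeSemiring using (solve; con; _:=_; _:+_; _:*_)
  open MonoidMult +-monoid using (×-homo-+)
  open RingProperties ring using (-0#≈0#)
  open SetoidReasoning setoid
  open SemiringExp semiring using (^-homo-*)
  open StaircaseProbability F

  -- Finite sums, with conditions as factors 0 and 1.

  ⟦_⟧ : Bool → Carrier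
  ⟦ b ⟧ = if b then 1# else 0#

  ⟦⟧-∧ : ∀ x y → ⟦ x ∧ y ⟧ ≈ ⟦ x ⟧ * ⟦ y ⟧
  ⟦⟧-∧ true  y = sym (*-identityˡ ⟦ y ⟧)
  ⟦⟧-∧ false y = sym (zeroˡ ⟦ y ⟧)

  module _ {ℓ} {A : Set ℓ} where

    sumOver-cong : ∀ (xs : List A) {f g} → (∀ x → f x ≈ g x) → sumOver xs f ≈ sumOver xs g
    sumOver-cong []       f≈g = refl
    sumOver-cong (x ∷ xs) f≈g = +-cong (f≈g x) (sumOver-cong xs f≈g)

    sumOver-zero : ∀ (xs : List A) → sumOver xs (λ _ → 0#) ≈ 0#
    sumOver-zero []       = refl
    sumOver-zero (x ∷ xs) = trans (+-identityˡ _) (sumOver-zero xs)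

    sumOver-+ : ∀ (xs : List A) f g → sumOver xs (λ x → f x + g x) ≈ sumOver xs f + sumOver xs g
    sumOver-+ []       f g = sym (+-identityˡ 0#)
    sumOver-+ (x ∷ xs) f g = trans (+-congˡ (sumOver-+ xs f g))
      (solve 4 (λ p q r s → (p :+ q) :+ (r :+ s) := (p :+ r) :+ (q :+ s)) refl _ _ _ _)

    sumOver-*ˡ : ∀ (xs : List A) z f → sumOver xs (λ x → z * f x) ≈ z * sumOver xs f
    sumOver-*ˡ []       z f = sym (zeroʳ z)
    sumOver-*ˡ (x ∷ xs) z f = trans (+-congˡ (sumOver-*ˡ xs z f)) (sym (distribˡ z _ _))

    sumOver-++ : ∀ (xs ys : List A) f → sumOver (xs List.++ ys) f ≈ sumOver xs f + sumOver ys f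
    sumOver-++ []       ys f = sym (+-identityˡ _)
    sumOver-++ (x ∷ xs) ys f = trans (+-congˡ (sumOver-++ xs ys f)) (sym (+-assoc _ _ _))

    sumOver-map : ∀ {ℓ′} {B : Set ℓ′} (g : A → B) (xs : List A) f →
                  sumOver (List.map g xs) f ≡ sumOver xs (f ∘ g)
    sumOver-map g []       f = ≡.refl
    sumOver-map g (x ∷ xs) f = ≡.cong (f (g x) +_) (sumOver-map g xs f)

    sumOver-filter : ∀ {ℓ′} {P : Pred A ℓ′} (P? : Decidable P) (xs : List A) f →
                     sumOver (filter P? xs) f ≈ sumOver xs (λ x → ⟦ does (P? x) ⟧ * f x)
    sumOver-filter P? []       f = refl
    sumOver-filter P? (x ∷ xs) f with P? x
    ... | yes _ = +-cong (sym (*-identityˡ (f x))) (sumOver-filter P? xs f)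
    ... | no _  = trans (sumOver-filter P? xs f)
                    (trans (sym (+-identityˡ _)) (+-congʳ (sym (zeroˡ (f x)))))

  module _ {ℓ₁ ℓ₂} {A : Set ℓ₁} {B : Set ℓ₂} where

    sumOver-swap : ∀ (xs : List A) (ys : List B) (f : A → B → Carrier) →
                   sumOver xs (λ x → sumOver ys (f x)) ≈ sumOver ys (λ y → sumOver xs (λ x → f x y))
    sumOver-swap []       ys f = sym (sumOver-zero ys)
    sumOver-swap (x ∷ xs) ys f = trans (+-congˡ (sumOver-swap xs ys f)) (sym (sumOver-+ ys _ _))

    sumOver-cartesian : ∀ {ℓ₃} {C : Set ℓ₃} (g : A → B → C) xs ys f →
                        sumOver (cartesianProductWith g xs ys) f ≈
                        sumOver xs (λ x → sumOver ys (λ y → f (g x y)))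
    sumOver-cartesian g []       ys f = refl
    sumOver-cartesian g (x ∷ xs) ys f = trans (sumOver-++ (List.map (g x) ys) _ f)
      (+-cong (reflexive (sumOver-map (g x) ys f)) (sumOver-cartesian g xs ys f))

  -- Weighted sums over a single row.

  module _ (α β : Carrier) where

    rowWt : ∀ {m} → Vec Cell m → Carrier
    rowWt r = α ^ count (_≟ᶜ just `α) r * β ^ count (_≟ᶜ just `β) r

    wt-∷ : ∀ {n} r (S : Filling n) → wt α β (r ∷ S) ≈ rowWt r * wt α β S
    wt-∷ r S = trans (*-cong (^-homo-* α (count (_≟ᶜ just `α) r) (number `α S))
                             (^-homo-* β (count (_≟ᶜ just `β) r) (number `β S)))
      (solve 4 (λ p q r s → (p :* q) :* (r :* s) := (p :* r) :* (q :* s)) refl _ _ _ _)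

    -- A transfer operator on functions `h` of the column state. Leaving `h` arbitrary allows the
    -- sum over one row to be inserted into the sum over the row below it.
    rowSum : ∀ {m} → (Vec Cell (suc m) → Bool) → Vec Bool m → (Vec Bool (suc m) → Carrier) → Carrier
    rowSum {m} q v h = sumOver (rows (suc m)) λ r → ⟦ fits v r ∧ q r ⟧ * (rowWt r * h (placeRow v r))

    -- The continuation of a row after its first symbol, where β is no longer possible.
    αRowSum : ∀ {m} → (Vec Cell (suc m) → Bool) → Vec Bool m → (Vec Bool (suc m) → Carrier) → Carrier
    αRowSum q = rowSum (λ r → withoutβ r ∧ q r)

    rowSum-congᵇ : ∀ {m} {q q′ : Vec Cell (suc m) → Bool} v h →
                   (∀ r → q r ≡ q′ r) → rowSum q v h ≈ rowSum q′ v h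
    rowSum-congᵇ {m} v h q≡ = sumOver-cong (rows (suc m)) λ r →
      *-congʳ (reflexive (≡.cong (λ t → ⟦ fits v r ∧ t ⟧) (q≡ r)))

    rowSum-*ˡ : ∀ {m} (q : Vec Cell (suc m) → Bool) v z h → rowSum q v (λ w → z * h w) ≈ z * rowSum q v h
    rowSum-*ˡ {m} q v z h = trans
      (sumOver-cong (rows (suc m)) λ r →
        solve 4 (λ t x z y → t :* (x :* (z :* y)) := z :* (t :* (x :* y))) refl _ _ z _)
      (sumOver-*ˡ (rows (suc m)) z _)

    rowSum-empty : ∀ {m} (v : Vec Bool m) h → rowSum (λ _ → false) v h ≈ 0#
    rowSum-empty {m} v h = trans (sumOver-cong (rows (suc m)) λ r →
      trans (*-congʳ (reflexive (≡.cong ⟦_⟧ (∧-zeroʳ (fits v r))))) (zeroˡ _)) (sumOver-zero (rows (suc m)))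

    rowSum-[] : ∀ q h → rowSum q [] h ≈
                ⟦ q (just `α ∷ []) ⟧ * (α * h (false ∷ [])) + ⟦ q (just `β ∷ []) ⟧ * (β * h (true ∷ []))
    rowSum-[] q h =
      solve 7 (λ x y α β f g e → con 0 :* e :+ (x :* (((α :* con 1) :* con 1) :* f)
                 :+ (y :* ((con 1 :* (β :* con 1)) :* g) :+ con 0))
                 := x :* (α :* f) :+ y :* (β :* g))
        refl ⟦ q (just `α ∷ []) ⟧ ⟦ q (just `β ∷ []) ⟧ α β (h (false ∷ [])) (h (true ∷ [])) _

    αRowSum-[] : ∀ q h → αRowSum q [] h ≈ ⟦ q (just `α ∷ []) ⟧ * (α * h (false ∷ []))
    αRowSum-[] q h = trans (rowSum-[] (λ r → withoutβ r ∧ q r) h)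
      (trans (+-congˡ (zeroˡ _)) (+-identityʳ _))

    -- Case distinction on the leftmost box. A symbol there needs a free column, hence the factor
    -- `⟦ b ⟧`; an α closes the column, a β keeps it free.
    rowSum-∷ : ∀ {m} (q : Vec Cell (suc (suc m)) → Bool) b (v : Vec Bool m) h →
               rowSum q (b ∷ v) h ≈
               rowSum (q ∘ (nothing ∷_)) v (h ∘ (b ∷_)) +
               ⟦ b ⟧ * (α * αRowSum (q ∘ (just `α ∷_)) v (h ∘ (false ∷_)) +
                        β * αRowSum (q ∘ (just `β ∷_)) v (h ∘ (true ∷_)))
    rowSum-∷ {m} q b v h = begin
      rowSum q (b ∷ v) h
        ≈⟨ sumOver-cartesian _∷_ cells (rows (suc m)) _ ⟩
      sumOver (rows (suc m)) (term ∘ (nothing ∷_)) +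
        (sumOver (rows (suc m)) (term ∘ (just `α ∷_)) + (sumOver (rows (suc m)) (term ∘ (just `β ∷_)) + 0#))
        ≈⟨ +-cong (sumOver-cong (rows (suc m)) empty) (+-cong
             (trans (sumOver-cong (rows (suc m)) filledα) (sumOver-*ˡ (rows (suc m)) (⟦ b ⟧ * α) _))
             (+-congʳ (trans (sumOver-cong (rows (suc m)) filledβ) (sumOver-*ˡ (rows (suc m)) (⟦ b ⟧ * β) _)))) ⟩
      _ + (⟦ b ⟧ * α * _ + (⟦ b ⟧ * β * _ + 0#))
        ≈⟨ solve 6 (λ e t α β x y → e :+ ((t :* α) :* x :+ ((t :* β) :* y :+ con 0))
                     := e :+ t :* (α :* x :+ β :* y)) refl _ ⟦ b ⟧ α β _ _ ⟩
      _ ∎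
      where
      term : Vec Cell (suc (suc m)) → Carrier
      term r = ⟦ fits (b ∷ v) r ∧ q r ⟧ * (rowWt r * h (placeRow (b ∷ v) r))

      gates : ∀ b w f q → ⟦ (b ∧ (w ∧ f)) ∧ q ⟧ ≈ ⟦ b ⟧ * ⟦ f ∧ (w ∧ q) ⟧
      gates false w     f     q = sym (zeroˡ _)
      gates true  false true  q = sym (*-identityˡ _)
      gates true  false false q = sym (*-identityˡ _)
      gates true  true  f     q = sym (*-identityˡ _)

      empty : ∀ r → term (nothing ∷ r) ≈
              ⟦ fits v r ∧ q (nothing ∷ r) ⟧ * (rowWt r * h (b ∷ placeRow v r))
      empty r = *-congˡ (*-congˡ (reflexive (≡.cong (λ b → h (b ∷ placeRow v r)) (∧-identityʳ b))))

      filledα : ∀ r → term (just `α ∷ r) ≈ (⟦ b ⟧ * α) *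
                (⟦ fits v r ∧ (withoutβ r ∧ q (just `α ∷ r)) ⟧ * (rowWt r * h (false ∷ placeRow v r)))
      filledα r = trans (*-cong (gates b (withoutβ r) (fits v r) (q (just `α ∷ r)))
                  (*-congˡ (reflexive (≡.cong (λ b → h (b ∷ placeRow v r)) (∧-zeroʳ b)))))
        (solve 6 (λ b g α x y h → (b :* g) :* (((α :* x) :* y) :* h) := (b :* α) :* (g :* ((x :* y) :* h)))
          refl _ _ α _ _ _)

      filledβ : ∀ r → term (just `β ∷ r) ≈ (⟦ b ⟧ * β) *
                (⟦ fits v r ∧ (withoutβ r ∧ q (just `β ∷ r)) ⟧ * (rowWt r * h (true ∷ placeRow v r)))
      -- The new state of the column is `b ∧ true`; it may be replaced by `true` because the summand
      -- vanishes when `b` is false.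
      filledβ r = helper b
        where
        helper : ∀ b → ⟦ (b ∧ (withoutβ r ∧ fits v r)) ∧ q (just `β ∷ r) ⟧ *
                   (rowWt (just `β ∷ r) * h ((b ∧ true) ∷ placeRow v r)) ≈ (⟦ b ⟧ * β) *
                (⟦ fits v r ∧ (withoutβ r ∧ q (just `β ∷ r)) ⟧ * (rowWt r * h (true ∷ placeRow v r)))
        helper false = solve 4 (λ x β y z → con 0 :* x := (con 0 :* β) :* (y :* z)) refl _ β _ _
        helper true  = trans (*-congʳ (gates true (withoutβ r) (fits v r) (q (just `β ∷ r))))
          (solve 6 (λ b g β x y h → (b :* g) :* ((x :* (β :* y)) :* h) := (b :* β) :* (g :* ((x :* y) :* h)))
            refl 1# _ β _ _ _)

    αRowSum-∷ : ∀ {m} (q : Vec Cell (suc (suc m)) → Bool) b (v : Vec Bool m) h →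
                αRowSum q (b ∷ v) h ≈
                αRowSum (q ∘ (nothing ∷_)) v (h ∘ (b ∷_)) +
                ⟦ b ⟧ * (α * αRowSum (q ∘ (just `α ∷_)) v (h ∘ (false ∷_)))
    αRowSum-∷ q b v h = trans (rowSum-∷ (λ r → withoutβ r ∧ q r) b v h)
      (+-congˡ (*-congˡ (trans (+-cong
        (*-congˡ (rowSum-congᵇ v (h ∘ (false ∷_)) λ r → idem (withoutβ r) _))
        (*-congˡ (trans (rowSum-congᵇ v (h ∘ (true ∷_)) λ r → ∧-zeroʳ (withoutβ r)) (rowSum-empty v (h ∘ (true ∷_))))))
        (trans (+-congˡ (zeroʳ β)) (+-identityʳ _)))))
      where
      idem : ∀ x y → x ∧ (x ∧ y) ≡ x ∧ y
      idem x y = ≡.trans (≡.sym (∧-assoc x x y)) (≡.cong (_∧ y) (∧-idem x))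

    pow : Carrier → ∀ {m} → Vec Bool m → Carrier
    pow y []          = 1#
    pow y (true ∷ v)  = y * pow y v
    pow y (false ∷ v) = pow y v

    always : ∀ {A : Set} → A → Bool
    always _ = true

    never : ∀ {A : Set} → A → Bool
    never _ = false

    -- With α's only, the columns are independent: a free column contributes y if left empty and α
    -- if filled, a closed one contributes 1, the diagonal box α.
    αRowSum-pow : ∀ {m} (v : Vec Bool m) y → αRowSum always v (pow y) ≈ α * pow (y + α) v
    αRowSum-pow []          y = trans (αRowSum-[] always (pow y)) (*-identityˡ _)
    αRowSum-pow (false ∷ v) y = trans (αRowSum-∷ always false v (pow y))
      (trans (+-cong (αRowSum-pow v y) (zeroˡ _)) (+-identityʳ _))
    αRowSum-pow (true ∷ v)  y = trans (αRowSum-∷ always true v (pow y))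
      (trans (+-cong (trans (rowSum-*ˡ _ v y (pow y)) (*-congˡ (αRowSum-pow v y)))
                     (*-congˡ (*-congˡ (αRowSum-pow v y))))
        (solve 3 (λ y α p → y :* (α :* p) :+ con 1 :* (α :* (α :* p)) := α :* ((y :+ α) :* p)) refl y α _))

    -- Only the leftmost symbol of a row can be β. Turning a leftmost α into β replaces its
    -- contribution α by βy, as the column stays free; so the sum over the rows of α's is multiplied
    -- by 1 + βy/α.
    rowSum-pow : ∀ {m} (v : Vec Bool m) y →
                 rowSum always v (pow y) ≈ (α + β * y) * pow (y + α) v
    rowSum-pow []          y = trans (rowSum-[] always (pow y))
      (solve 3 (λ α β y → con 1 :* (α :* con 1) :+ con 1 :* (β :* (y :* con 1)) := (α :+ β :* y) :* con 1)
        refl α β y)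
    rowSum-pow (false ∷ v) y = trans (rowSum-∷ always false v (pow y))
      (trans (+-cong (rowSum-pow v y) (zeroˡ _)) (+-identityʳ _))
    rowSum-pow (true ∷ v)  y = trans (rowSum-∷ always true v (pow y))
      (trans (+-cong (trans (rowSum-*ˡ _ v y (pow y)) (*-congˡ (rowSum-pow v y)))
                     (*-congˡ (+-cong (*-congˡ (αRowSum-pow v y))
                       (*-congˡ (trans (rowSum-*ˡ _ v y (pow y)) (*-congˡ (αRowSum-pow v y)))))))
        (solve 4 (λ y α β p → y :* ((α :+ β :* y) :* p) :+
                     con 1 :* (α :* (α :* p) :+ β :* (y :* (α :* p)))
                   := (α :+ β :* y) :* ((y :+ α) :* p)) refl y α β _))

    -- Two rows around an α on the second main diagonal.

    penultα : ∀ {m} → Vec Cell (suc m) → Bool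
    penultα {m} r = isα (cell r m)

    -- The last entry of the state belongs to the diagonal box of the row below; `false` records an
    -- α there, which clears the box above it.
    fits-penultα-blocked : ∀ {m} (v : Vec Bool m) r → fits (v ∷ʳ false) r ∧ penultα r ≡ false
    fits-penultα-blocked []          (nothing ∷ r) = ∧-zeroʳ (fits [] r)
    fits-penultα-blocked []          (just _ ∷ r)  = ≡.refl
    fits-penultα-blocked (b ∷ v)     (nothing ∷ r) = fits-penultα-blocked v r
    fits-penultα-blocked (false ∷ v) (just _ ∷ r)  = ≡.refl
    fits-penultα-blocked (true ∷ v)  (just _ ∷ r)  with withoutβ r
    ... | true  = fits-penultα-blocked v r
    ... | false = ≡.refl

    rowSum-penultα-blocked : ∀ {m} (v : Vec Bool m) h → rowSum penultα (v ∷ʳ false) h ≈ 0#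
    rowSum-penultα-blocked {m} v h = trans
      (sumOver-cong (rows (suc (suc m))) λ r →
        trans (*-congʳ (reflexive (≡.cong ⟦_⟧ (fits-penultα-blocked v r)))) (zeroˡ _))
      (sumOver-zero (rows (suc (suc m))))

    -- A row without β has α on the diagonal, so its new state ends in `false`, where `h` vanishes.
    αRowSum-last : ∀ {m} (v : Vec Bool m) h → (∀ w → h (w ∷ʳ false) ≈ 0#) → αRowSum always v h ≈ 0#
    αRowSum-last []      h h≈0 = trans (αRowSum-[] always h)
      (trans (*-congˡ (trans (*-congˡ (h≈0 [])) (zeroʳ α))) (zeroʳ _))
    αRowSum-last (b ∷ v) h h≈0 = trans (αRowSum-∷ always b v h)
      (trans (+-cong (αRowSum-last v (h ∘ (b ∷_)) (h≈0 ∘ (b ∷_)))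
                     (*-congˡ (*-congˡ (αRowSum-last v (h ∘ (false ∷_)) (h≈0 ∘ (false ∷_))))))
        (solve 2 (λ t α → con 0 :+ t :* (α :* con 0) := con 0) refl ⟦ b ⟧ α))

    -- Only a β on the diagonal survives, and it empties the rest of the row: a single row remains,
    -- which leaves the old columns as they were.
    rowSum-last : ∀ {m} (v : Vec Bool m) h → (∀ w → h (w ∷ʳ false) ≈ 0#) →
                  rowSum always v h ≈ β * h (v ∷ʳ true)
    rowSum-last []      h h≈0 = trans (rowSum-[] always h)
      (trans (+-cong (trans (*-congˡ (trans (*-congˡ (h≈0 [])) (zeroʳ α))) (zeroʳ _)) (*-identityˡ _))
        (+-identityˡ _))
    rowSum-last (b ∷ v) h h≈0 = trans (rowSum-∷ always b v h)
      (trans (+-cong (rowSum-last v (h ∘ (b ∷_)) (h≈0 ∘ (b ∷_)))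
                     (*-congˡ (+-cong
                       (*-congˡ (αRowSum-last v (h ∘ (false ∷_)) (h≈0 ∘ (false ∷_))))
                       (*-congˡ (αRowSum-last v (h ∘ (true ∷_)) (h≈0 ∘ (true ∷_)))))))
        (solve 4 (λ t α β x → β :* x :+ t :* (α :* con 0 :+ β :* con 0) := β :* x) refl ⟦ b ⟧ α β _))

    -- The last two boxes both hold α and close their columns; the columns before them behave as in
    -- `αRowSum-pow`.
    αRowSum-penultα : ∀ {m} (v : Vec Bool m) y →
                      αRowSum penultα (v ∷ʳ true) (pow y) ≈ α * α * pow (y + α) v
    αRowSum-penultα []          y = trans (αRowSum-∷ penultα true [] (pow y))
      -- Here the first box is itself the penultimate one, so `penultα` computes to `never` after an
      -- empty box and to `always` after an α.
      (trans (+-cong (αRowSum-[] never (pow y ∘ (true ∷_))) (*-congˡ (*-congˡ (αRowSum-[] always (pow y ∘ (false ∷_))))))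
        (solve 2 (λ α x → con 0 :* x :+ con 1 :* (α :* (con 1 :* (α :* con 1))) := α :* α :* con 1) refl α _))
    αRowSum-penultα (false ∷ v) y = trans (αRowSum-∷ penultα false (v ∷ʳ true) (pow y))
      (trans (+-cong (αRowSum-penultα v y) (zeroˡ _)) (+-identityʳ _))
    αRowSum-penultα (true ∷ v)  y = trans (αRowSum-∷ penultα true (v ∷ʳ true) (pow y))
      (trans (+-cong (trans (rowSum-*ˡ _ (v ∷ʳ true) y (pow y)) (*-congˡ (αRowSum-penultα v y)))
                     (*-congˡ (*-congˡ (αRowSum-penultα v y))))
        (solve 3 (λ y α p → y :* (α :* α :* p) :+ con 1 :* (α :* (α :* α :* p)) := α :* α :* ((y :+ α) :* p))
          refl y α _))

    -- The subtracted term is moved to the left, which keeps the identity within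
    -- reach of the semiring solver.
    rowSum-penultα : ∀ {m} (v : Vec Bool m) y →
                     rowSum penultα (v ∷ʳ true) (pow y) + α * β * y * pow y v ≈
                     α * (α + β * y) * pow (y + α) v
    rowSum-penultα []          y = trans (+-congʳ (trans (rowSum-∷ penultα true [] (pow y))
        (+-cong (rowSum-[] never (pow y ∘ (true ∷_)))
          (*-congˡ (+-cong (*-congˡ (αRowSum-[] always (pow y ∘ (false ∷_))))
                           (*-congˡ (αRowSum-[] never (pow y ∘ (true ∷_)))))))))
      (solve 5 (λ α β y x z → (con 0 :* x :+ con 0 :* z) :+
                    con 1 :* (α :* (con 1 :* (α :* con 1)) :+ β :* (con 0 :* x)) :+ α :* β :* y :* con 1
                  := α :* (α :+ β :* y) :* con 1)
        refl α β y _ _)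
    rowSum-penultα (false ∷ v) y = trans
      (+-congʳ (trans (rowSum-∷ penultα false (v ∷ʳ true) (pow y)) (trans (+-congˡ (zeroˡ _)) (+-identityʳ _))))
      (rowSum-penultα v y)
    rowSum-penultα (true ∷ v)  y = begin
      rowSum penultα (true ∷ (v ∷ʳ true)) (pow y) + α * β * y * (y * pow y v)
        ≈⟨ +-congʳ (trans (rowSum-∷ penultα true (v ∷ʳ true) (pow y))
             (+-cong (rowSum-*ˡ _ (v ∷ʳ true) y (pow y))
               (*-congˡ (+-cong (*-congˡ (αRowSum-penultα v y))
                 (*-congˡ (trans (rowSum-*ˡ _ (v ∷ʳ true) y (pow y)) (*-congˡ (αRowSum-penultα v y)))))))) ⟩
      y * rowSum penultα (v ∷ʳ true) (pow y) + 1# * (α * (α * α * u) + β * (y * (α * α * u)))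
        + α * β * y * (y * pow y v)
        ≈⟨ solve 6 (λ y α β x u p →
               y :* x :+ con 1 :* (α :* (α :* α :* u) :+ β :* (y :* (α :* α :* u))) :+ α :* β :* y :* (y :* p)
             := y :* (x :+ α :* β :* y :* p) :+ (α :+ β :* y) :* (α :* α :* u))
             refl y α β _ u (pow y v) ⟩
      y * (rowSum penultα (v ∷ʳ true) (pow y) + α * β * y * pow y v) + (α + β * y) * (α * α * u)
        ≈⟨ +-congʳ (*-congˡ (rowSum-penultα v y)) ⟩
      y * (α * (α + β * y) * u) + (α + β * y) * (α * α * u)
        ≈⟨ solve 4 (λ y α β u → y :* (α :* (α :+ β :* y) :* u) :+ (α :+ β :* y) :* (α :* α :* u)
             := α :* (α :+ β :* y) :* ((y :+ α) :* u)) refl y α β u ⟩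
      α * (α + β * y) * ((y + α) * u) ∎
      where u = pow (y + α) v

    -- An α next to the diagonal in the upper row kills the terms in which the
    -- lower row ends in α, see rowSum-penultα-blocked.
    pairSum : ∀ {m} → Carrier → Vec Bool m → Carrier
    pairSum y v = rowSum always v (λ w → rowSum penultα w (pow y))

    -- The lower row shrinks to its diagonal β, which supplies the factor β and a free column for
    -- the α above.
    pairSum-pow : ∀ {m} (v : Vec Bool m) y →
                  pairSum y v + α * β * (β * y) * pow y v ≈ α * β * (α + β * y) * pow (y + α) v
    pairSum-pow v y = begin
      pairSum y v + α * β * (β * y) * pow y v
        ≈⟨ +-congʳ (rowSum-last v (λ w → rowSum penultα w (pow y)) (λ w → rowSum-penultα-blocked w (pow y))) ⟩
      β * rowSum penultα (v ∷ʳ true) (pow y) + α * β * (β * y) * pow y v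
        ≈⟨ solve 5 (λ α β x y p → β :* x :+ α :* β :* (β :* y) :* p := β :* (x :+ α :* β :* y :* p))
             refl α β _ y _ ⟩
      β * (rowSum penultα (v ∷ʳ true) (pow y) + α * β * y * pow y v)
        ≈⟨ *-congˡ (rowSum-penultα v y) ⟩
      β * (α * (α + β * y) * pow (y + α) v)
        ≈⟨ solve 4 (λ α β x u → β :* (α :* x :* u) := α :* β :* x :* u) refl α β _ _ ⟩
      α * β * (α + β * y) * pow (y + α) v ∎

    -- Sums over all tableaux of a given size.

    total : ∀ {n} → (Filling n → Bool) → (Vec Bool n → Carrier) → Carrier
    total {n} p h = sumOver (fillings n) λ S → ⟦ valid S ∧ p S ⟧ * (wt α β S * h (free S))

    total-cong : ∀ {n} (p : Filling n → Bool) {h h′} → (∀ v → h v ≈ h′ v) → total p h ≈ total p h′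
    total-cong {n} p h≈ = sumOver-cong (fillings n) λ S → *-congˡ (*-congˡ (h≈ (free S)))

    total-*ˡ : ∀ {n} (p : Filling n → Bool) z h → total p (λ v → z * h v) ≈ z * total p h
    total-*ˡ {n} p z h = trans
      (sumOver-cong (fillings n) λ S →
        solve 4 (λ t x z y → t :* (x :* (z :* y)) := z :* (t :* (x :* y))) refl _ _ z _)
      (sumOver-*ˡ (fillings n) z _)

    total-+ : ∀ {n} (p : Filling n → Bool) h h′ → total p (λ v → h v + h′ v) ≈ total p h + total p h′
    total-+ {n} p h h′ = trans
      (sumOver-cong (fillings n) λ S →
        solve 4 (λ t x y z → t :* (x :* (y :+ z)) := t :* (x :* y) :+ t :* (x :* z)) refl _ _ _ _)
      (sumOver-+ (fillings n) _ _)

    -- The top row interacts with the rows below only through `free S`. After exchanging the sums it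
    -- can be summed with `S` fixed, which gives a new function of the state of `S`.
    total-∷ : ∀ {n} {p : Filling n → Bool} {p′ : Filling (suc n) → Bool} (q : Vec Cell (suc n) → Bool) h →
              (∀ r S → p′ (r ∷ S) ≡ q r ∧ p S) → total p′ h ≈ total p (λ v → rowSum q v h)
    total-∷ {n} {p} {p′} q h p′≡ = begin
      total p′ h
        ≈⟨ sumOver-cartesian _∷_ (rows (suc n)) (fillings n) _ ⟩
      sumOver (rows (suc n)) (λ r → sumOver (fillings n) (λ S → term (r ∷ S)))
        ≈⟨ sumOver-swap (rows (suc n)) (fillings n) (λ r S → term (r ∷ S)) ⟩
      sumOver (fillings n) (λ S → sumOver (rows (suc n)) (λ r → term (r ∷ S)))
        ≈⟨ sumOver-cong (fillings n) (λ S → trans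
             (sumOver-cong (rows (suc n)) (split S))
             (trans (sumOver-*ˡ (rows (suc n)) (⟦ valid S ∧ p S ⟧ * wt α β S) _) (*-assoc _ _ _))) ⟩
      total p (λ v → rowSum q v h) ∎
      where
      term : Filling (suc n) → Carrier
      term S = ⟦ valid S ∧ p′ S ⟧ * (wt α β S * h (free S))

      gates : ∀ f v q p → ⟦ (f ∧ v) ∧ (q ∧ p) ⟧ ≈ ⟦ v ∧ p ⟧ * ⟦ f ∧ q ⟧
      gates f v q p = begin
        ⟦ (f ∧ v) ∧ (q ∧ p) ⟧           ≈⟨ trans (⟦⟧-∧ (f ∧ v) (q ∧ p)) (*-cong (⟦⟧-∧ f v) (⟦⟧-∧ q p)) ⟩
        (⟦ f ⟧ * ⟦ v ⟧) * (⟦ q ⟧ * ⟦ p ⟧) ≈⟨ solve 4 (λ f v q p → (f :* v) :* (q :* p) := (v :* p) :* (f :* q)) refl _ _ _ _ ⟩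
        (⟦ v ⟧ * ⟦ p ⟧) * (⟦ f ⟧ * ⟦ q ⟧) ≈⟨ *-cong (⟦⟧-∧ v p) (⟦⟧-∧ f q) ⟨
        ⟦ v ∧ p ⟧ * ⟦ f ∧ q ⟧           ∎

      split : ∀ S r → term (r ∷ S) ≈ (⟦ valid S ∧ p S ⟧ * wt α β S) *
              (⟦ fits (free S) r ∧ q r ⟧ * (rowWt r * h (placeRow (free S) r)))
      split S r = trans
        (*-cong (trans (reflexive (≡.cong (λ t → ⟦ valid (r ∷ S) ∧ t ⟧) (p′≡ r S)))
                       (gates (fits (free S) r) (valid S) (q r) (p S)))
                (*-congʳ (wt-∷ r S)))
        (solve 5 (λ a b x y z → (a :* b) :* ((x :* y) :* z) := (a :* y) :* (b :* (x :* z))) refl _ _ _ _ _)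

    -- Closed form of the generating functions.

    linears : ℕ → Carrier → Carrier
    linears zero    y = 1#
    linears (suc k) y = linears k y * (α + β * y + fromℕ k * (α * β))

    -- Replacing y by y + α adds αβ to every factor, hence moves each index up by one; α + βy is the
    -- missing factor of index 0.
    linears-shift : ∀ k y → (α + β * y) * linears k (y + α) ≈ linears (suc k) y
    linears-shift zero    y = solve 2 (λ x z → x :* con 1 := con 1 :* (x :+ con 0 :* z)) refl _ (α * β)
    linears-shift (suc k) y = begin
      (α + β * y) * (linears k (y + α) * (α + β * (y + α) + fromℕ k * (α * β)))
        ≈⟨ solve 5 (λ α β y l n → (α :+ β :* y) :* (l :* (α :+ β :* (y :+ α) :+ n :* (α :* β)))
             := ((α :+ β :* y) :* l) :* (α :+ β :* y :+ (con 1 :+ n) :* (α :* β))) refl α β y _ _ ⟩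
      ((α + β * y) * linears k (y + α)) * (α + β * y + (1# + fromℕ k) * (α * β))
        ≈⟨ *-congʳ (linears-shift k y) ⟩
      linears (suc (suc k)) y ∎

    module _ (b : Carrier) where

      -- j is the column of the s-th α from the left, so that suc j ∸ s * 2 counts
      -- the rows below that α which do not belong to a pair.
      factor : ℕ → ℕ → Carrier
      factor j s = α * β * (α * β) * (b + fromℕ (suc j ∸ s ℕ.* 2))

      -- Runs from the rightmost α, which is the topmost, to the left. Removing the last column from
      -- `j` therefore removes the head of the product by computation alone.
      factors : ∀ {r} → (Fin r → ℕ) → Carrier
      factors {r} j = product (λ k → factor (j (opposite k)) (r ∸ toℕ k))

      -- Quantified over y because the induction needs the value at y + α, and for a pair of rows
      -- also the value at y.
      Evaluates : ∀ {n r} → (Fin r → ℕ) → (Filling n → Bool) → Set _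
      Evaluates {n} {r} j p = ∀ y → total p (pow y) ≈ factors j * linears (n ∸ r ℕ.* 2) y

      module _ (βb≈1 : β * b ≈ 1#) where

        evaluate-∷ : ∀ {n r} (j : Fin r → ℕ) {p : Filling n → Bool} {p′ : Filling (suc n) → Bool} →
                     (∀ row S → p′ (row ∷ S) ≡ p S) → r ℕ.* 2 ≤ n →
                     Evaluates j p → Evaluates j p′
        evaluate-∷ {n} {r} j {p} {p′} p′≡ room ev y = begin
          total p′ (pow y)
            ≈⟨ total-∷ always (pow y) p′≡ ⟩
          total p (λ v → rowSum always v (pow y))
            ≈⟨ total-cong p (λ v → rowSum-pow v y) ⟩
          total p (λ v → (α + β * y) * pow (y + α) v)
            ≈⟨ total-*ˡ p (α + β * y) (pow (y + α)) ⟩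
          (α + β * y) * total p (pow (y + α))
            ≈⟨ *-congˡ (ev (y + α)) ⟩
          (α + β * y) * (factors j * linears (n ∸ r ℕ.* 2) (y + α))
            ≈⟨ solve 3 (λ x f l → x :* (f :* l) := f :* (x :* l)) refl _ _ _ ⟩
          factors j * ((α + β * y) * linears (n ∸ r ℕ.* 2) (y + α))
            ≈⟨ *-congˡ (linears-shift (n ∸ r ℕ.* 2) y) ⟩
          factors j * linears (suc (n ∸ r ℕ.* 2)) y
            ≡⟨ ≡.cong (λ k → factors j * linears k y) (ℕ.+-∸-assoc 1 room) ⟨
          factors j * linears (suc n ∸ r ℕ.* 2) y ∎

        evaluate-∷∷ : ∀ {n r} (j : Fin (suc r) → ℕ) {p : Filling n → Bool} {p′ : Filling (suc (suc n)) → Bool} →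
                      (∀ row₂ row₁ S → p′ (row₂ ∷ row₁ ∷ S) ≡ penultα row₂ ∧ p S) → j (Fin.fromℕ r) ≡ suc n →
                      Evaluates (j ∘ inject₁) p → Evaluates j p′
        -- The negative term of the pair step is carried on both sides and cancelled only at the
        -- end.
        evaluate-∷∷ {n} {r} j {p} {p′} p′≡ jr≡ ev y = +-cancelʳ (α * β * (β * y) * (f * l)) _ _ (begin
          total p′ (pow y) + α * β * (β * y) * (f * l)
            ≈⟨ +-cong (trans (total-∷ {p = p″} penultα (pow y) λ { r₂ (r₁ ∷ S) → p′≡ r₂ r₁ S })
                             (total-∷ {p = p} always (λ v → rowSum penultα v (pow y)) λ _ _ → ≡.refl))
                      (*-congˡ (sym (ev y))) ⟩
          total p (pairSum y) + α * β * (β * y) * total p (pow y)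
            ≈⟨ +-congˡ (sym (total-*ˡ p _ (pow y))) ⟩
          total p (pairSum y) + total p (λ v → α * β * (β * y) * pow y v)
            ≈⟨ sym (total-+ p (pairSum y) (λ v → α * β * (β * y) * pow y v)) ⟩
          total p (λ v → pairSum y v + α * β * (β * y) * pow y v)
            ≈⟨ total-cong p (λ v → pairSum-pow v y) ⟩
          total p (λ v → α * β * (α + β * y) * pow (y + α) v)
            ≈⟨ total-*ˡ p _ (pow (y + α)) ⟩
          α * β * (α + β * y) * total p (pow (y + α))
            ≈⟨ *-congˡ (ev (y + α)) ⟩
          α * β * (α + β * y) * (f * linears k (y + α))
            ≈⟨ solve 4 (λ c x f l → c :* x :* (f :* l) := c :* f :* (x :* l)) refl _ _ _ _ ⟩
          α * β * f * ((α + β * y) * linears k (y + α))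
            ≈⟨ *-congˡ (linears-shift k y) ⟩
          α * β * f * (l * (α + β * y + fromℕ k * (α * β)))
            -- With α written as α(βb), the bracket splits into αβ(b + k) and βy; the second part
            -- produces the term to be cancelled.
            ≈⟨ *-congˡ (*-congˡ (+-congʳ (+-congʳ (sym (trans (*-congˡ βb≈1) (*-identityʳ α)))))) ⟩
          α * β * f * (l * (α * (β * b) + β * y + fromℕ k * (α * β)))
            ≈⟨ solve 7 (λ α β b y k f l → α :* β :* f :* (l :* (α :* (β :* b) :+ β :* y :+ k :* (α :* β)))
                 := α :* β :* (α :* β) :* (b :+ k) :* f :* l :+ α :* β :* (β :* y) :* (f :* l))
                 refl α β b y (fromℕ k) f l ⟩
          α * β * (α * β) * (b + fromℕ k) * f * l + α * β * (β * y) * (f * l)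
            -- For i = n + 1 the difference computes to `k`: both sides lose the two rows of the new
            -- pair.
            ≡⟨ ≡.cong (λ i → α * β * (α * β) * (b + fromℕ (suc i ∸ suc r ℕ.* 2)) * f * l + α * β * (β * y) * (f * l)) jr≡ ⟨
          factors j * linears (suc (suc n) ∸ suc r ℕ.* 2) y + α * β * (β * y) * (f * l) ∎)
          where
          k = n ∸ r ℕ.* 2
          f = factors (j ∘ inject₁)
          l = linears k y
          p″ : Filling (suc n) → Bool
          p″ (_ ∷ S) = p S

        -- The top row carries a prescribed α exactly when the largest column is the last one of the
        -- second diagonal. In that case the gap keeps the other prescribed boxes out of the two top
        -- rows.
        evaluate : ∀ n {r} (j : Fin r → ℕ) → (∀ k → 1 ≤ j k) → Gapped j → (∀ k → j k ℕ.< n) →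
                   Evaluates j (allα {n} j)
        evaluate zero {zero}  j _ _ _   y = solve 0 (con 1 :* (con 1 :* con 1 :* con 1) :+ con 0 := con 1 :* con 1) refl
        evaluate zero {suc r} j _ _ j<n y with () ← j<n zero
        evaluate (suc n) {zero} j 1≤j gap j<n =
          evaluate-∷ {n} j {allα j} {allα j} (λ row S → allα-∷ j row S λ ()) z≤n (evaluate n j (λ ()) gap λ ())
        evaluate (suc n) {suc r} j 1≤j gap j<n with ℕ.m≤n⇒m<n∨m≡n (ℕ.s≤s⁻¹ (j<n (Fin.fromℕ r)))
        ... | inj₁ last<n = evaluate-∷ {n} j {allα j} {allα j} (λ row S → allα-∷ j row S below)
                (Gapped-room j 1≤j gap below) (evaluate n j 1≤j gap below)
          where
          below : ∀ k → j k ℕ.< n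
          below k with view k
          ... | ‵fromℕ     = last<n
          ... | ‵inject₁ k = ℕ.≤-trans (ℕ.+-monoʳ-≤ 1 (ℕ.m≤m+n _ 2))
                  (ℕ.≤-trans (s≤s (gap (inject₁<fromℕ k))) last<n)
        evaluate (suc zero)    {suc r} j 1≤j gap j<n | inj₂ last≡n
          with () ← ≡.subst (1 ≤_) last≡n (1≤j (Fin.fromℕ r))
        evaluate (suc (suc n)) {suc r} j 1≤j gap j<n | inj₂ last≡n =
          evaluate-∷∷ {n} j {allα (j ∘ inject₁)} {allα j} (λ row₂ row₁ S → allα-last j row₂ row₁ S last≡n below) last≡n
            (evaluate n (j ∘ inject₁) (1≤j ∘ inject₁) (Gapped-init gap) below)
          where
          below : ∀ k → j (inject₁ k) ℕ.< n
          below k = ℕ.s≤s⁻¹ (≡.subst₂ _≤_ (ℕ.+-comm _ 2) last≡n (gap (inject₁<fromℕ k)))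

  -- Field arithmetic for the quotient.

  inverseʳ : ∀ {x} (x#0 : x # 0#) → x * x ⁻¹[ x#0 ] ≈ 1#
  inverseʳ {x} x#0 = trans (*-congʳ (sym x-0≈x)) (proj₂ (proj₂ (#⇒invertible x#0)))
    where
    -- Apartness of x from 0 provides an inverse of the difference x - 0.
    x-0≈x : x - 0# ≈ x
    x-0≈x = trans (+-congˡ -0#≈0#) (+-identityʳ x)

  -- The inverse of x is y/z. This serves the denominators, whose subtractions hide that a positive
  -- multiple of them is a product of positive terms.
  factor-#0 : ∀ {x y z} → x * y ≈ z → z # 0# → x # 0#
  factor-#0 {x} {y} {z} xy≈z z#0 = invertible⇒# (w , trans (*-comm w (x - 0#)) inv , inv)
    where
    w = y * z ⁻¹[ z#0 ]
    inv : (x - 0#) * w ≈ 1#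
    inv = begin
      (x - 0#) * w            ≈⟨ *-congʳ (trans (+-congˡ -0#≈0#) (+-identityʳ x)) ⟩
      x * (y * z ⁻¹[ z#0 ])   ≈⟨ *-assoc x y _ ⟨
      (x * y) * z ⁻¹[ z#0 ]   ≈⟨ *-congʳ xy≈z ⟩
      z * z ⁻¹[ z#0 ]         ≈⟨ inverseʳ z#0 ⟩
      1#                      ∎

  -- Reduces the subtractions in the field to one equation of natural numbers. `X` and `z` are free
  -- up to `≈` to absorb the order of the summands and the use of `1#` for `fromℕ 1`.
  collect : ∀ {X x z} m p q c d → X ≈ x + fromℕ m → z ≈ fromℕ c → m ℕ.+ q ≡ d ℕ.+ p ℕ.+ c →
            X - fromℕ p + fromℕ q - z ≈ x + fromℕ d
  collect {X} {x} {z} m p q c d X≈ z≈ eq = begin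
    X - fromℕ p + fromℕ q - z
      ≈⟨ +-congʳ (+-congʳ (+-congʳ X≈)) ⟩
    x + fromℕ m - fromℕ p + fromℕ q - z
      ≈⟨ solve 5 (λ x m p q z → x :+ m :+ p :+ q :+ z := x :+ (m :+ q) :+ p :+ z) refl x _ _ _ _ ⟩
    x + (fromℕ m + fromℕ q) - fromℕ p - z
      ≈⟨ +-congʳ (+-congʳ (+-congˡ (trans (sym (×-homo-+ 1# m q)) (trans (reflexive (≡.cong fromℕ eq))
           (trans (×-homo-+ 1# (d ℕ.+ p) c) (+-cong (×-homo-+ 1# d p) (sym z≈))))))) ⟩
    x + (fromℕ d + fromℕ p + z) - fromℕ p - z
      -- The negatives enter the semiring solver as independent variables.
      ≈⟨ solve 6 (λ x d p z p⁻ z⁻ → x :+ (d :+ p :+ z) :+ p⁻ :+ z⁻ := x :+ d :+ ((p :+ p⁻) :+ (z :+ z⁻)))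
           refl x _ _ z _ _ ⟩
    x + fromℕ d + ((fromℕ p - fromℕ p) + (z - z))
      ≈⟨ +-congˡ (trans (+-cong (-‿inverseʳ _) (-‿inverseʳ z)) (+-identityˡ 0#)) ⟩
    x + fromℕ d + 0#
      ≈⟨ +-identityʳ _ ⟩
    x + fromℕ d ∎

  -- Each factor raises the index of L by two; the first starts at n - 2r, the last ends at n.
  product-telescope : ∀ n r → r ℕ.* 2 ≤ n → (L : ℕ → Carrier) (f t : Fin r → Carrier) →
    (∀ k → let e = n ∸ (r ∸ toℕ k) ℕ.* 2 in f k * L e ≈ t k * L (suc (suc e))) →
    product f * L (n ∸ r ℕ.* 2) ≈ product t * L n
  product-telescope n zero    room L f t step = refl
  product-telescope n (suc r) room L f t step = begin
    f zero * product (f ∘ suc) * L (n ∸ suc r ℕ.* 2)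
      ≈⟨ solve 3 (λ x y z → x :* y :* z := y :* (x :* z)) refl _ _ _ ⟩
    product (f ∘ suc) * (f zero * L (n ∸ suc r ℕ.* 2))
      ≈⟨ *-congˡ (step zero) ⟩
    product (f ∘ suc) * (t zero * L (suc (suc (n ∸ suc r ℕ.* 2))))
      ≡⟨ ≡.cong (λ e → product (f ∘ suc) * (t zero * L e)) (ℕ.+-∸-assoc 2 room) ⟨
    product (f ∘ suc) * (t zero * L (n ∸ r ℕ.* 2))
      ≈⟨ solve 3 (λ x y z → x :* (y :* z) := y :* (x :* z)) refl _ _ _ ⟩
    t zero * (product (f ∘ suc) * L (n ∸ r ℕ.* 2))
      ≈⟨ *-congˡ (product-telescope n r (ℕ.m+n≤o⇒n≤o 2 room) L (f ∘ suc) (t ∘ suc) (step ∘ suc)) ⟩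
    t zero * (product (t ∘ suc) * L n)
      ≈⟨ *-assoc _ _ _ ⟨
    t zero * product (t ∘ suc) * L n ∎

  -- From generating functions at y = 1 to probabilities.

  module _ (n : ℕ) {α β : Carrier} (α>0 : 0# < α) (β>0 : 0# < β)
           {r} (j : Fin r → ℕ) (j<n : ∀ k → j k ℕ.< n) where

    a = 1# / α [ >⇒#0 α>0 ]
    b = 1# / β [ >⇒#0 β>0 ]

    prob : Carrier
    prob = ℙ n α>0 β>0 (λ k → αOnSecondDiagonal n (j k))

    num den : Fin r → Carrier
    num k = b + fromℕ (j (opposite k)) - fromℕ (2 ℕ.* r) + fromℕ (2 ℕ.* suc (toℕ k)) - 1#
    den k = (fromℕ n + a + b - fromℕ (2 ℕ.* r) + fromℕ (2 ℕ.* suc (toℕ k)) - 1#)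
          * (fromℕ n + a + b - fromℕ (2 ℕ.* r) + fromℕ (2 ℕ.* suc (toℕ k)) - fromℕ 2)

    αa≈1 : α * a ≈ 1#
    αa≈1 = trans (*-congˡ (*-identityˡ _)) (inverseʳ (>⇒#0 α>0))

    βb≈1 : β * b ≈ 1#
    βb≈1 = trans (*-congˡ (*-identityˡ _)) (inverseʳ (>⇒#0 β>0))

    Z⁻¹ : Carrier
    Z⁻¹ = Z n α β ⁻¹[ >⇒#0 (Z-positive n α>0 β>0) ]

    pow-1 : ∀ {m} (v : Vec Bool m) → pow α β 1# v ≈ 1#
    pow-1 []          = refl
    pow-1 (true ∷ v)  = trans (*-identityˡ _) (pow-1 v)
    pow-1 (false ∷ v) = pow-1 v

    prob-total : prob ≈ Z⁻¹ * total α β (allα {n} j) (pow α β 1#)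
    prob-total = begin
      prob
        ≈⟨ sumOver-filter (Event.occurs? (Allα {n} j)) (tableaux n) _ ⟩
      sumOver (tableaux n) (λ S → ⟦ allα {n} j S ⟧ * (wt α β S * Z⁻¹))
        ≈⟨ sumOver-filter isTableau? (fillings n) _ ⟩
      sumOver (fillings n) (λ S → ⟦ does (isTableau? S) ⟧ * (⟦ allα {n} j S ⟧ * (wt α β S * Z⁻¹)))
        ≈⟨ sumOver-cong (fillings n) (λ S → trans (*-congʳ (reflexive (≡.cong ⟦_⟧ (does-isTableau? S))))
             (trans (solve 4 (λ v p w z → v :* (p :* (w :* z)) := z :* ((v :* p) :* (w :* con 1))) refl _ _ _ Z⁻¹)
               (*-congˡ (*-cong (sym (⟦⟧-∧ (valid S) (allα {n} j S))) (*-congˡ (sym (pow-1 (free S)))))))) ⟩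
      sumOver (fillings n) (λ S → Z⁻¹ * (⟦ valid S ∧ allα {n} j S ⟧ * (wt α β S * pow α β 1# (free S))))
        ≈⟨ sumOver-*ˡ (fillings n) Z⁻¹ _ ⟩
      Z⁻¹ * total α β (allα {n} j) (pow α β 1#) ∎

    -- The partition function is the evaluation with no prescribed α.
    Z-linears : Z n α β ≈ linears α β n 1#
    Z-linears = begin
      Z n α β
        ≈⟨ sumOver-filter isTableau? (fillings n) _ ⟩
      sumOver (fillings n) (λ S → ⟦ does (isTableau? S) ⟧ * wt α β S)
        ≈⟨ sumOver-cong (fillings n) (λ S → *-cong
             (reflexive (≡.cong ⟦_⟧ (≡.trans (does-isTableau? S) (≡.sym (∧-identityʳ _)))))
             (trans (sym (*-identityʳ _)) (*-congˡ (sym (pow-1 (free S)))))) ⟩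
      total α β (allα {n} none) (pow α β 1#)
        ≈⟨ evaluate α β b βb≈1 n none (λ ()) (λ { {()} }) (λ ()) 1# ⟩
      1# * linears α β n 1#
        ≈⟨ *-identityˡ _ ⟩
      linears α β n 1# ∎
      where
      none : Fin 0 → ℕ
      none ()

    -- By α = αβb and β = αβa; this is how a + b enters the denominators.
    linear : ∀ e → α + β * 1# + fromℕ e * (α * β) ≈ α * β * (a + b + fromℕ e)
    linear e = begin
      α + β * 1# + fromℕ e * (α * β)
        ≈⟨ +-congʳ (+-cong (sym (trans (*-congˡ βb≈1) (*-identityʳ α))) (*-congˡ (sym αa≈1))) ⟩
      α * (β * b) + β * (α * a) + fromℕ e * (α * β)
        ≈⟨ solve 5 (λ α β a b e → α :* (β :* b) :+ β :* (α :* a) :+ e :* (α :* β)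
             := α :* β :* (a :+ b :+ e)) refl α β a b _ ⟩
      α * β * (a + b + fromℕ e) ∎

    linear-positive : ∀ e → 0# < α + β * 1# + fromℕ e * (α * β)
    linear-positive zero    = <-respʳ-≈
      (solve 3 (λ α β z → α :+ β := α :+ β :* con 1 :+ con 0 :* z) refl α β (α * β)) (+-positive α>0 β>0)
    linear-positive (suc e) = <-respʳ-≈
      (solve 4 (λ α β e z → z :+ (α :+ β :* con 1 :+ e :* z) := α :+ β :* con 1 :+ (con 1 :+ e) :* z)
        refl α β _ (α * β)) (+-positive (*-positive α>0 β>0) (linear-positive e))

    -- No offending pair has to be found: a single tableau in the event would prove separation, so
    -- the list of such tableaux is empty.
    prob-zero : (∀ k l → k Fin.< l → j k ℕ.< j l) →
                ¬ (∀ k l → toℕ l ≡ suc (toℕ k) → j k ℕ.+ 2 ≤ j l) → prob ≈ 0#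
    prob-zero mono ¬sep = reflexive (≡.cong (λ xs → sumOver xs (ℙ₁ n α>0 β>0))
      (filter-none (Event.occurs? (Allα j))
        (All.map (λ t occ → ¬sep (allα⇒separated j j<n mono t occ)) (all-filter isTableau? (fillings n)))))

    module _ (1≤j : ∀ k → 1 ≤ j k) (gap : Gapped j) where

      room : r ℕ.* 2 ≤ n
      room = Gapped-room j 1≤j gap j<n

      remaining : Fin r → ℕ
      remaining k = n ∸ (r ∸ toℕ k) ℕ.* 2

      index-split : ∀ k → (r ∸ toℕ k) ℕ.+ toℕ k ≡ r
      index-split k = ℕ.m∸n+n≡m (ℕ.<⇒≤ (toℕ<n k))

      -- Used with m = j + 1 for the numerators and m = n for the denominators, in the form that
      -- `collect` expects.
      balance : ∀ k m → (r ∸ toℕ k) ℕ.* 2 ≤ m →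
                m ℕ.+ 2 ℕ.* suc (toℕ k) ≡ (m ∸ (r ∸ toℕ k) ℕ.* 2) ℕ.+ 2 ℕ.* r ℕ.+ 2
      -- Both m and r are rewritten as sums, so that the truncated differences become variables of
      -- the solver.
      balance k m s≤m = ≡.subst₂ (λ m′ r′ → m′ ℕ.+ 2 ℕ.* suc (toℕ k) ≡ (m ∸ s ℕ.* 2) ℕ.+ 2 ℕ.* r′ ℕ.+ 2)
        (ℕ.m∸n+n≡m s≤m) (index-split k)
        (+-*-Solver.solve 3 (λ e s k → e +-*-Solver.:+ s +-*-Solver.:* +-*-Solver.con 2
             +-*-Solver.:+ +-*-Solver.con 2 +-*-Solver.:* (+-*-Solver.con 1 +-*-Solver.:+ k)
           +-*-Solver.:= e +-*-Solver.:+ +-*-Solver.con 2 +-*-Solver.:* (s +-*-Solver.:+ k) +-*-Solver.:+ +-*-Solver.con 2)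
          ≡.refl (m ∸ s ℕ.* 2) s (toℕ k))
        where s = r ∸ toℕ k

      num≈ : ∀ k → num k ≈ b + fromℕ (suc (j (opposite k)) ∸ (r ∸ toℕ k) ℕ.* 2)
      num≈ k = collect (j (opposite k)) (2 ℕ.* r) (2 ℕ.* suc (toℕ k)) 1 (suc (j (opposite k)) ∸ (r ∸ toℕ k) ℕ.* 2)
        refl (sym (+-identityʳ 1#))
        (ℕ.suc-injective (≡.trans (balance k (suc (j (opposite k))) s≤) (ℕ.+-suc _ 1)))
        where
        s≤ : (r ∸ toℕ k) ℕ.* 2 ≤ suc (j (opposite k))
        s≤ = ≡.subst (λ s → s ℕ.* 2 ≤ suc (j (opposite k)))
          (≡.trans (≡.cong suc (opposite-prop k)) (≡.sym (ℕ.+-∸-assoc 1 (toℕ<n k))))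
          (s≤s (Gapped-lower j 1≤j gap (opposite k)))

      den≈ : ∀ k → den k ≈ (a + b + fromℕ (suc (remaining k))) * (a + b + fromℕ (remaining k))
      den≈ k = *-cong
        (collect n (2 ℕ.* r) (2 ℕ.* suc (toℕ k)) 1 (suc (remaining k)) n+a+b (sym (+-identityʳ 1#)) (≡.trans bal (ℕ.+-suc _ 1)))
        (collect n (2 ℕ.* r) (2 ℕ.* suc (toℕ k)) 2 (remaining k) n+a+b refl bal)
        where
        bal = balance k n (ℕ.≤-trans (ℕ.*-monoˡ-≤ 2 (ℕ.m∸n≤m r (toℕ k))) room)
        n+a+b : fromℕ n + a + b ≈ a + b + fromℕ n
        n+a+b = solve 3 (λ n a b → n :+ a :+ b := a :+ b :+ n) refl _ _ _

      -- The right side consists of the two factors by which L_{e+2}(1) exceeds L_e(1), with e =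
      -- `remaining k`.
      den-linear : ∀ k → let lin = λ e → α + β * 1# + fromℕ e * (α * β) in
                   den k * (α * β * (α * β)) ≈ lin (remaining k) * lin (suc (remaining k))
      den-linear k = trans (*-congʳ (den≈ k)) (trans
        (solve 3 (λ x y c → x :* y :* (c :* c) := (c :* y) :* (c :* x)) refl _ _ (α * β))
        (sym (*-cong (linear (remaining k)) (linear (suc (remaining k))))))

      den#0 : ∀ k → den k # 0#
      den#0 k = factor-#0 (den-linear k)
        (>⇒#0 (*-positive (linear-positive (remaining k)) (linear-positive (suc (remaining k)))))

      ratio : Fin r → Carrier
      ratio k = num k / den k [ den#0 k ]

      ratio-linears : ∀ k → factor α β b (j (opposite k)) (r ∸ toℕ k) * linears α β (remaining k) 1# ≈
                            ratio k * linears α β (suc (suc (remaining k))) 1#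
      ratio-linears k = sym (begin
        num k * d⁻¹ * (L * _ * _)
          ≈⟨ solve 5 (λ x d l u v → x :* d :* (l :* u :* v) := x :* l :* d :* (u :* v)) refl _ _ _ _ _ ⟩
        num k * L * d⁻¹ * (_ * _)
          ≈⟨ *-congˡ (sym (den-linear k)) ⟩
        num k * L * d⁻¹ * (den k * (α * β * (α * β)))
          ≈⟨ solve 5 (λ x l i d c → x :* l :* i :* (d :* c) := (d :* i) :* (c :* x :* l)) refl _ _ _ _ _ ⟩
        den k * d⁻¹ * (α * β * (α * β) * num k * L)
          ≈⟨ trans (*-congʳ (inverseʳ (den#0 k))) (*-identityˡ _) ⟩
        α * β * (α * β) * num k * L
          ≈⟨ *-congʳ (*-congˡ (num≈ k)) ⟩
        factor α β b (j (opposite k)) (r ∸ toℕ k) * L ∎)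
        where
        L = linears α β (remaining k) 1#
        d⁻¹ = den k ⁻¹[ den#0 k ]

      prob-product : prob ≈ product ratio
      prob-product = begin
        prob
          ≈⟨ prob-total ⟩
        Z⁻¹ * total α β (allα {n} j) (pow α β 1#)
          ≈⟨ *-congˡ (evaluate α β b βb≈1 n j 1≤j gap j<n 1#) ⟩
        Z⁻¹ * (factors α β b j * linears α β (n ∸ r ℕ.* 2) 1#)
          ≈⟨ *-congˡ (product-telescope n r room (λ e → linears α β e 1#) _ ratio ratio-linears) ⟩
        Z⁻¹ * (product ratio * linears α β n 1#)
          ≈⟨ *-congˡ (*-congˡ (sym Z-linears)) ⟩
        Z⁻¹ * (product ratio * Z n α β)
          ≈⟨ solve 3 (λ i p z → i :* (p :* z) := p :* (z :* i)) refl _ _ _ ⟩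
        product ratio * (Z n α β * Z⁻¹)
          ≈⟨ trans (*-congˡ (inverseʳ (>⇒#0 (Z-positive n α>0 β>0)))) (*-identityʳ _) ⟩
        product ratio ∎

theorem3p3 : ∀ {c ℓ₁ ℓ₂ ℓ₃} (F : OrderedField c ℓ₁ ℓ₂ ℓ₃) →
  let open OrderedField F
      open StaircaseProbability F
  in
  (n : ℕ) → 2 ≤ n →
  (α β : Carrier) (α>0 : 0# < α) (β>0 : 0# < β) →
  (r : ℕ) (j : Fin r → ℕ) →
  (∀ k → 1 ≤ j k × j k ≤ n ∸ 1) →
  (∀ k l → k Fin.< l → j k ℕ.< j l) →
  let a = 1# / α [ >⇒#0 α>0 ]
      b = 1# / β [ >⇒#0 β>0 ]
      Separated = ∀ k l → toℕ l ≡ suc (toℕ k) → j k ℕ.+ 2 ≤ j l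
      -- k : Fin r stands for the 1-based index ι k, and opposite k for r + 1 ∸ ι k
      ι = λ (k : Fin r) → suc (toℕ k)
      num = λ (k : Fin r) →
        b + fromℕ (j (opposite k)) - fromℕ (2 ℕ.* r) + fromℕ (2 ℕ.* ι k) - 1#
      den = λ (k : Fin r) →
        (fromℕ n + a + b - fromℕ (2 ℕ.* r) + fromℕ (2 ℕ.* ι k) - 1#)
        * (fromℕ n + a + b - fromℕ (2 ℕ.* r) + fromℕ (2 ℕ.* ι k) - fromℕ 2)
      prob = ℙ n α>0 β>0 (λ k → αOnSecondDiagonal n (j k))
  in
  (Separated → Σ (∀ k → den k # 0#) λ den#0 → prob ≈ product (λ k → num k / den k [ den#0 k ]))
  × (¬ Separated → prob ≈ 0#)
theorem3p3 F n 2≤n α β α>0 β>0 r j bounds mono =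
    (λ sep → let gap = separated⇒Gapped mono sep in
       den#0 n α>0 β>0 j j<n 1≤j gap , prob-product n α>0 β>0 j j<n 1≤j gap)
  , prob-zero n α>0 β>0 j j<n mono
  where
  open Weights F
  1≤j : ∀ k → 1 ≤ j k
  1≤j k = proj₁ (bounds k)
  j<n : ∀ k → j k ℕ.< n
  j<n k = ℕ.≤-trans (s≤s (proj₂ (bounds k))) (ℕ.≤-reflexive (ℕ.m+[n∸m]≡n (ℕ.≤-trans (s≤s z≤n) 2≤n)))
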